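{- Let $R(X)$ be interpreted as "$|X|$ is a prime number". The relation $EqCard$, as well as the graphs of $+$ and $\times$, are $\{<,R\}$-finite-definable.
   Context: $\mathcal{F}$ denotes the set of finite subsets of $\mathbb{N}$ and $|X|$ the cardinality of $X\in\mathcal{F}$. $EqCard(X,Y)$ is the binary relation on $\mathcal{F}$ which holds iff $|X|=|Y|$. $R$ is a unary relation on $\mathcal{F}$. Formulas of monadic second-order logic (MSO) over $\{<,R\}$ use first-order variables ranging over the domain, monadic second-order variables ranging over subsets of the domain, membership $x\in X$, and the symbols $<$ and $R$ ($R$ takes one monadic second-order argument). For $q\ge 1$, $\mathcal{M}_q=([0,q),<,R)$ is the finite structure with domain $[0,q)=\{0,\dots,q-1\}$, in which $<$ is the usual order restricted to $[0,q)$ and $R$ is restricted to subsets of $[0,q)$. A relation $S\subseteq\mathcal{F}^n$ is $\{<,R\}$-finite-definable if there is a single MSO formula $\varphi(X_1,\dots,X_n)$ over $\{<,R\}$ such that for every $q\ge 1$ the relation defined by $\varphi$ in $\mathcal{M}_q$ is exactly the set of tuples $(X_1,\dots,X_n)\in S$ with $X_i\subseteq[0,q)$ for all $i$. Similarly, a relation $S\subseteq\mathbb{N}^m$ is $\{<,R\}$-finite-definable if there is a single MSO formula $\varphi(x_1,\dots,x_m)$ with first-order free variables such that for every $q\ge1$ the relation defined by $\varphi$ in $\mathcal{M}_q$ is $S\cap[0,q)^m$. The graph of $+$ (resp. $\times$) is $\{(x,y,z)\in\mathbb{N}^3 : x+y=z\}$ (resp. $\{(x,y,z)\in\mathbb{N}^3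 : xy=z\}$). -}

module Defs where

open import Data.Fin as Fin using (Fin; toℕ)
open import Data.Fin.Subset as Subset using (Subset)
open import Data.Fin.Subset.Properties using (_∈?_)
open import Data.List using (List; length; map; filter; allFin)
open import Data.List.Membership.Propositional as List using ()
open import Data.List.Membership.Propositional.Properties
  using (∈-map∘filter⁺; ∈-map∘filter⁻; ∈-allFin)
open import Data.List.Relation.Unary.AllPairs using (AllPairs)
open import Data.List.Relation.Unary.AllPairs.Properties
  using (map⁺; filter⁺; tabulate⁺-<)
open import Data.Nat using (ℕ; suc; _+_; _*_; _<_; _≥_)
open import Data.Nat.Primality using (Prime)
open import Data.Product using (∃; ∃-syntax; _×_; _,_)
open import Data.Sum using (_⊎_)
open import Data.Vec as Vec using (Vec; []; _∷_; lookup)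
open import Function using (id; _⇔_; mk⇔)
open import Level using (0ℓ)
open import Relation.Binary.PropositionalEquality using (_≡_; refl)
open import Relation.Nullary using (¬_)
open import Relation.Unary using (Pred)

-- A finite subset of ℕ is given by its elements in strictly increasing order,
-- so that each set has exactly one enumeration and its cardinality is the
-- length of that enumeration.
record ℱ : Set where
  constructor mkℱ
  field
    elements   : List ℕ
    increasing : AllPairs _<_ elements

open ℱ public

infix 4 _∈ℱ_
_∈ℱ_ : ℕ → ℱ → Set
x ∈ℱ X = x List.∈ elements X

card : ℱ → ℕ
card X = length (elements X)

-- Subset q is the powerset of [0,q); toℱ is the inclusion of this powerset
-- into ℱ.  Its image consists of the X : ℱ with X ⊆ [0,q).
toℱ : ∀ {q} → Subset q → ℱ
toℱ {q} X = mkℱ (map toℕ (filter (_∈? X) (allFin q)))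
                (map⁺ (filter⁺ (_∈? X) (tabulate⁺-< id)))

∈-toℱ : ∀ {q} (X : Subset q) {x} →
        x ∈ℱ toℱ X ⇔ (∃[ i ] i Subset.∈ X × x ≡ toℕ i)
∈-toℱ {q} X = mk⇔
  (λ x∈ → let i , _ , eq , i∈X = ∈-map∘filter⁻ toℕ (_∈? X) {xs = allFin q} x∈ in i , i∈X , eq)
  (λ (i , i∈X , eq) → ∈-map∘filter⁺ toℕ (_∈? X) (i , ∈-allFin i , eq , i∈X))

-- MSO m n: formulas over {<,R} whose free variables are among m first-order
-- and n monadic second-order variables (de Bruijn indices).  There is no atom
-- for equality, since x = y is ¬ (x < y) ∧ ¬ (y < x) in a linear order.
infix  8 _<ᶠ_ _∈ᶠ_
infix  7 ¬ᶠ_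
infixr 6 _∧ᶠ_
infixr 5 _∨ᶠ_
infixr 4 _⇒ᶠ_

data MSO (m n : ℕ) : Set where
  _<ᶠ_           : Fin m → Fin m → MSO m n
  _∈ᶠ_           : Fin m → Fin n → MSO m n
  Rᶠ             : Fin n → MSO m n
  ¬ᶠ_            : MSO m n → MSO m n
  _∧ᶠ_ _∨ᶠ_ _⇒ᶠ_ : MSO m n → MSO m n → MSO m n
  ∀¹ ∃¹          : MSO (suc m) n → MSO m n
  ∀² ∃²          : MSO m (suc n) → MSO m n

module _ (R : Pred ℱ 0ℓ) where

  -- Satisfaction in 𝓜_q = ([0,q),<,R).
  Sat : (q : ℕ) {m n : ℕ} → MSO m n → Vec (Fin q) m → Vec (Subset q) n → Set
  Sat q (i <ᶠ j) xs Xs = lookup xs i Fin.< lookup xs j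
  Sat q (i ∈ᶠ j) xs Xs = lookup xs i Subset.∈ lookup Xs j
  Sat q (Rᶠ j)   xs Xs = R (toℱ (lookup Xs j))
  Sat q (¬ᶠ φ)   xs Xs = ¬ Sat q φ xs Xs
  Sat q (φ ∧ᶠ ψ) xs Xs = Sat q φ xs Xs × Sat q ψ xs Xs
  Sat q (φ ∨ᶠ ψ) xs Xs = Sat q φ xs Xs ⊎ Sat q ψ xs Xs
  Sat q (φ ⇒ᶠ ψ) xs Xs = Sat q φ xs Xs → Sat q ψ xs Xs
  Sat q (∀¹ φ)   xs Xs = (x : Fin q) → Sat q φ (x ∷ xs) Xs
  Sat q (∃¹ φ)   xs Xs = ∃ λ (x : Fin q) → Sat q φ (x ∷ xs) Xs
  Sat q (∀² φ)   xs Xs = (X : Subset q) → Sat q φ xs (X ∷ Xs)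
  Sat q (∃² φ)   xs Xs = ∃ λ (X : Subset q) → Sat q φ xs (X ∷ Xs)

  FiniteDefinableℱ : {n : ℕ} → Pred (Vec ℱ n) 0ℓ → Set
  FiniteDefinableℱ {n} S =
    ∃ λ (φ : MSO 0 n) → ∀ q → q ≥ 1 → (Xs : Vec (Subset q) n) →
      Sat q φ [] Xs ⇔ S (Vec.map toℱ Xs)

  FiniteDefinableℕ : {m : ℕ} → Pred (Vec ℕ m) 0ℓ → Set
  FiniteDefinableℕ {m} S =
    ∃ λ (φ : MSO m 0) → ∀ q → q ≥ 1 → (xs : Vec (Fin q) m) →
      Sat q φ xs [] ⇔ S (Vec.map toℕ xs)

PrimeCard : Pred ℱ 0ℓ
PrimeCard X = Prime (card X)

EqCard : Pred (Vec ℱ 2) 0ℓ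
EqCard (X ∷ Y ∷ []) = card X ≡ card Y

Graph+ : Pred (Vec ℕ 3) 0ℓ
Graph+ (x ∷ y ∷ z ∷ []) = x + y ≡ z

Graph× : Pred (Vec ℕ 3) 0ℓ
Graph× (x ∷ y ∷ z ∷ []) = x * y ≡ z

{-# OPTIONS --safe #-}

-- If |X| = |Y| then, for all Z disjoint from X and Y, |X ∪ Z| is prime iff
-- |Y ∪ Z| is.  Conversely, let |X| < |Y| ≤ s with s⁵ ≤ q, let d = |Y| - |X|, and
-- let p be a prime in (s, s³].  Choosing |Z| = p + n d - |X| for n < p shows that
-- p, p + d, …, p + p d = p (1 + d) are all prime, which is absurd.  So this
-- condition determines cardinalities up to about the fifth root of q.
--
-- Any formula that holds whenever |X| = |Y| may be strengthened by
-- "for every nonempty G, X and Y have the same cardinality when counted in blocks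
-- of size |G|"; taking |G| close to the fifth root of q, each round multiplies by
-- |G| the range in which the formula is exact, so nine rounds reach q.  No formula
-- defining a suitable G is needed.
--
-- The prime in (s, s³] comes from Nair's argument: the entries of the Leibniz
-- triangle show that a common multiple Q of 1, …, N satisfies Q ≥ 2^(N-1), whereas
-- if all primes up to N = s³ are at most s there is such a Q with Q ≤ N^s.
module Submission where

open import Defs
open import Data.Bool using (true; false)
open import Data.Empty using (⊥-elim)
open import Data.Fin as Fin using (Fin; zero; suc; toℕ)
open import Data.Fin.Patterns
import Data.Fin.Properties as Fin
open import Data.Fin.Subset renaming (⊥ to ∅)
open import Data.Fin.Subset.Properties
open import Data.List as List using ([]; _∷_; length; filter)
import Data.List.Properties as List
open import Data.List.Relation.Unary.All using (_∷_)
open import Data.Nat hiding (∣_-_∣)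
open import Data.Nat.Divisibility using (divides)
open import Data.Nat.Induction using (<-rec)
open import Data.Nat.Primality
open import Data.Nat.Primality.Factorisation using (factorise)
open import Data.Nat.Properties
open import Data.Nat.Tactic.RingSolver using (solve-∀)
open import Data.Product
open import Data.Sum
import Data.Unit as Unit
open import Data.Vec as Vec using (Vec; []; _∷_; here; there; lookup)
import Data.Vec.Properties as Vec
open import Function using (_∘_; _⇔_; mk⇔; Equivalence; id)
open import Level using (0ℓ)
open import Relation.Binary using (tri<; tri≈; tri>)
open import Relation.Binary.PropositionalEquality hiding ([_])
open import Relation.Nullary
open import Relation.Nullary.Decidable using (dec-true)
open import Relation.Unary using (Pred; Decidable)

-- Integer roots and uniqueness of division

n<2^n : ∀ n → n < 2 ^ n
n<2^n zero    = s≤s z≤n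
n<2^n (suc n) = begin-strict
  suc n         ≤⟨ n<2^n n ⟩
  2 ^ n         <⟨ m<m*n (2 ^ n) 2 {{m^n≢0 2 n}} (s≤s (s≤s z≤n)) ⟩
  2 ^ n * 2     ≡⟨ *-comm (2 ^ n) 2 ⟩
  2 ^ suc n     ∎
  where open ≤-Reasoning

-- Descending from `k`, the first index whose value is at most `N` is taken. This yields both
-- integer roots and integer logarithms.
greatest-below : ∀ (f : ℕ → ℕ) N → f 0 ≤ N → ∀ k → N < f k → ∃ λ e → f e ≤ N × N < f (suc e)
greatest-below f N f0≤N zero    N<f0 = ⊥-elim (<⇒≱ N<f0 f0≤N)
greatest-below f N f0≤N (suc k) N<fk with f k ≤? N
... | yes fk≤N = k , fk≤N , N<fk
... | no  fk≰N = greatest-below f N f0≤N k (≰⇒> fk≰N)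

divMod-unique : ∀ {g a b c d} → b < g → d < g → g * a + b ≡ g * c + d → a ≡ c × b ≡ d
divMod-unique {g} {a} {b} {c} {d} b<g d<g eq = a≡c ,
  +-cancelˡ-≡ (g * a) b d (trans eq (cong (λ c → g * c + d) (sym a≡c)))
  where
  open ≤-Reasoning
  ≮ : ∀ {a b c d} → b < g → g * a + b ≡ g * c + d → ¬ a < c
  ≮ {a} {b} {c} {d} b<g eq a<c = <-irrefl eq (begin-strict
    g * a + b    <⟨ +-monoʳ-< (g * a) b<g ⟩
    g * a + g    ≡⟨ +-comm (g * a) g ⟩
    g + g * a    ≡⟨ *-suc g a ⟨
    g * suc a    ≤⟨ *-monoʳ-≤ g a<c ⟩
    g * c        ≤⟨ m≤m+n (g * c) d ⟩
    g * c + d    ∎)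
  a≡c : a ≡ c
  a≡c = ≤-antisym (≮⇒≥ (≮ d<g (sym eq))) (≮⇒≥ (≮ b<g eq))

-- 1024 = 4⁵, so that γ ≥ 3 and (γ + 2)⁵ ≤ (2 γ)⁵ ≤ γ⁹.
fifth-root : ∀ {q} → 1024 ≤ q → ∃ λ γ → 3 ≤ γ × suc γ ^ 5 ≤ q × q < γ ^ 9 * suc γ
fifth-root {q} 1024≤q with greatest-below (_^ 5) q z≤n (suc q) (m≤m*n (suc q) (suc q ^ 4) {{m^n≢0 (suc q) 4}})
... | zero , _ , q<1 = ⊥-elim (<⇒≱ q<1 (≤-trans (s≤s z≤n) 1024≤q))
... | suc γ , s^5≤q , q<[1+s]^5 = γ , 3≤γ , s^5≤q , <-≤-trans q<[1+s]^5 (begin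
  (2 + γ) ^ 5           ≤⟨ ^-monoˡ-≤ 5 (+-monoˡ-≤ γ (≤-trans (s≤s (s≤s z≤n)) 3≤γ)) ⟩
  (γ + γ) ^ 5           ≡⟨ arith γ ⟩
  -- Here 49 + 32 = 81 = 3 ^ 4.
  32 * γ ^ 5            ≤⟨ *-monoˡ-≤ (γ ^ 5) (≤-trans (m≤n+m 32 49) (^-monoˡ-≤ 4 3≤γ)) ⟩
  γ ^ 4 * γ ^ 5         ≡⟨ ^-distribˡ-+-* γ 4 5 ⟨
  γ ^ 9                 ≤⟨ m≤m*n (γ ^ 9) (suc γ) ⟩
  γ ^ 9 * suc γ         ∎)
  where
  open ≤-Reasoning
  3≤γ : 3 ≤ γ
  3≤γ = ≮⇒≥ λ γ<3 → <⇒≱ q<[1+s]^5 (≤-trans (^-monoˡ-≤ 5 (s≤s γ<3)) 1024≤q)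
  arith : ∀ γ → (γ + γ) * ((γ + γ) * ((γ + γ) * ((γ + γ) * ((γ + γ) * 1)))) ≡
                32 * (γ * (γ * (γ * (γ * (γ * 1)))))
  arith = solve-∀

-- Primes in short intervals

module PrimeGap where

  open import Data.Nat.Divisibility

  -- binom i j is the binomial coefficient C(i + j, i).
  binom : ℕ → ℕ → ℕ
  binom zero    j       = 1
  binom (suc i) zero    = 1
  binom (suc i) (suc j) = binom i (suc j) + binom (suc i) j

  -- The reciprocals of these numbers are the entries of Leibniz's harmonic triangle, in row
  -- `i + j`.
  leibniz : ℕ → ℕ → ℕ
  leibniz i j = suc (i + j) * binom i j

  binom-nonZero : ∀ i j → NonZero (binom i j)
  binom-nonZero zero    j       = _
  binom-nonZero (suc i) zero    = _
  binom-nonZero (suc i) (suc j) =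
    >-nonZero (≤-trans (>-nonZero⁻¹ _ {{binom-nonZero i (suc j)}}) (m≤m+n _ _))

  leibniz-nonZero : ∀ i j → NonZero (leibniz i j)
  leibniz-nonZero i j = m*n≢0 (suc (i + j)) (binom i j) {{_}} {{binom-nonZero i j}}

  binom-zeroʳ : ∀ i → binom i 0 ≡ 1
  binom-zeroʳ zero    = refl
  binom-zeroʳ (suc i) = refl

  -- All sides equal (i + j + 1)! / (i! j!). The two identities are proved together: after Pascal's
  -- rule, they convert one of the two summands into a multiple of the other binomial.
  binom-sucˡ : ∀ i j → suc i * binom (suc i) j ≡ leibniz i j
  binom-sucʳ : ∀ i j → suc j * binom i (suc j) ≡ leibniz i j

  binom-sucˡ i zero rewrite binom-zeroʳ i | +-identityʳ i = refl
  binom-sucˡ i (suc j) = begin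
    suc i * (binom i (suc j) + binom (suc i) j)
      ≡⟨ *-distribˡ-+ (suc i) (binom i (suc j)) _ ⟩
    suc i * binom i (suc j) + suc i * binom (suc i) j
      ≡⟨ cong (suc i * binom i (suc j) +_) (trans (binom-sucˡ i j) (sym (binom-sucʳ i j))) ⟩
    suc i * binom i (suc j) + suc j * binom i (suc j)
      ≡⟨ *-distribʳ-+ (binom i (suc j)) (suc i) (suc j) ⟨
    (suc i + suc j) * binom i (suc j) ∎
    where open ≡-Reasoning

  binom-sucʳ zero    j = refl
  binom-sucʳ (suc i) j = begin
    suc j * (binom i (suc j) + binom (suc i) j)
      ≡⟨ *-distribˡ-+ (suc j) (binom i (suc j)) _ ⟩
    suc j * binom i (suc j) + suc j * binom (suc i) j
      ≡⟨ cong (_+ suc j * binom (suc i) j) (trans (binom-sucʳ i j) (sym (binom-sucˡ i j))) ⟩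
    suc i * binom (suc i) j + suc j * binom (suc i) j
      ≡⟨ *-distribʳ-+ (binom (suc i) j) (suc i) (suc j) ⟨
    (suc i + suc j) * binom (suc i) j
      ≡⟨ cong (_* binom (suc i) j) (+-suc (suc i) j) ⟩
    leibniz (suc i) j ∎
    where open ≡-Reasoning

  -- 1/L(i,j) = 1/L(i+1,j) + 1/L(i,j+1), cleared of denominators.
  leibniz-harmonic : ∀ i j → leibniz (suc i) j * leibniz i (suc j) ≡
                             leibniz i j * (leibniz (suc i) j + leibniz i (suc j))
  leibniz-harmonic i j = begin
    suc (suc i + j) * x * (suc (i + suc j) * y)
      ≡⟨ cong (λ n → suc (suc i + j) * x * (suc n * y)) (+-suc i j) ⟩
    suc (suc i + j) * x * (suc (suc i + j) * y)
      ≡⟨ lemma i j x y ⟩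
    suc (suc i + j) * (suc j * y * x + suc i * x * y)
      ≡⟨ cong₂ (λ a b → suc (suc i + j) * (a * x + b * y)) (binom-sucʳ i j) (binom-sucˡ i j) ⟩
    suc (suc i + j) * (leibniz i j * x + leibniz i j * y)
      ≡⟨ lemma′ (suc (suc i + j)) (leibniz i j) x y ⟩
    leibniz i j * (suc (suc i + j) * x + suc (suc i + j) * y)
      ≡⟨ cong (λ n → leibniz i j * (suc (suc i + j) * x + suc n * y)) (+-suc i j) ⟨
    leibniz i j * (suc (suc i + j) * x + suc (i + suc j) * y) ∎
    where
    open ≡-Reasoning
    x = binom (suc i) j
    y = binom i (suc j)
    lemma : ∀ i j x y → suc (suc i + j) * x * (suc (suc i + j) * y) ≡
                        suc (suc i + j) * (suc j * y * x + suc i * x * y)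
    lemma = solve-∀
    lemma′ : ∀ s l x y → s * (l * x + l * y) ≡ l * (s * x + s * y)
    lemma′ = solve-∀

  module _ {n Q} .{{_ : NonZero Q}} (∣Q : ∀ {m} → m ≥ 1 → m ≤ n → m ∣ Q) where

    -- Induction on `i`. On the edge, `leibniz 0 j` is `suc j`, one of 1, ..., n. Inside, Q / L₁ = Q
    -- / L - Q / L₂ by the harmonic relation, a difference of integers.
    leibniz-∣ : ∀ i j → i + j < n → leibniz i j ∣ Q
    leibniz-∣ zero    j j<n = subst (_∣ Q) (sym (*-identityʳ (suc j))) (∣Q (s≤s z≤n) j<n)
    leibniz-∣ (suc i) j i+j<n
      with leibniz-∣ i j (<-trans (n<1+n _) i+j<n)
         | leibniz-∣ i (suc j) (subst (_< n) (sym (+-suc i j)) i+j<n)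
    ... | divides a Q≡aL | divides b Q≡bL₂ =
      ∣m+n∣m⇒∣n (subst (L₁ ∣_) eq (n∣m*n a)) (n∣m*n b)
      where
      L  = leibniz i j
      L₁ = leibniz (suc i) j
      L₂ = leibniz i (suc j)
      open ≡-Reasoning
      l₁ : ∀ a b L₁ L₂ → a * L₁ * (b * L₂) ≡ a * b * (L₁ * L₂)
      l₁ = solve-∀
      l₂ : ∀ a b L L₁ L₂ → a * b * (L * (L₁ + L₂)) ≡ (b * L₁) * (a * L) + (a * L) * (b * L₂)
      l₂ = solve-∀
      eq : a * L₁ ≡ b * L₁ + Q
      eq = *-cancelʳ-≡ _ _ Q (begin
        a * L₁ * Q                             ≡⟨ cong (a * L₁ *_) Q≡bL₂ ⟩
        a * L₁ * (b * L₂)                      ≡⟨ l₁ a b L₁ L₂ ⟩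
        a * b * (L₁ * L₂)                      ≡⟨ cong (a * b *_) (leibniz-harmonic i j) ⟩
        a * b * (L * (L₁ + L₂))                ≡⟨ l₂ a b L L₁ L₂ ⟩
        b * L₁ * (a * L) + (a * L) * (b * L₂)  ≡⟨ cong₂ (λ u v → b * L₁ * u + u * v) Q≡aL Q≡bL₂ ⟨
        b * L₁ * Q + Q * Q                     ≡⟨ *-distribʳ-+ Q (b * L₁) Q ⟨
        (b * L₁ + Q) * Q                       ∎)

    -- In the rows below `n` every entry 1 / L is at least 1 / Q, since L divides Q. Each entry is
    -- the sum of the two under it, so going up `k` rows multiplies this lower bound by `2 ^ k`.
    2^*leibniz≤ : ∀ k i j → i + j + k < n → 2 ^ k * leibniz i j ≤ Q
    2^*leibniz≤ zero    i j i+j<n =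
      subst (_≤ Q) (sym (*-identityˡ _)) (∣⇒≤ (leibniz-∣ i j (subst (_< n) (+-identityʳ _) i+j<n)))
    2^*leibniz≤ (suc k) i j i+j+k<n =
      *-cancelʳ-≤ _ _ (L₁ + L₂) {{L₁+L₂≢0}} (begin
        2 * 2 ^ k * L * (L₁ + L₂)                ≡⟨ *-assoc (2 * 2 ^ k) L _ ⟩
        2 * 2 ^ k * (L * (L₁ + L₂))              ≡⟨ cong (2 * 2 ^ k *_) (leibniz-harmonic i j) ⟨
        2 * 2 ^ k * (L₁ * L₂)                    ≡⟨ l (2 ^ k) L₁ L₂ ⟩
        2 ^ k * L₂ * L₁ + 2 ^ k * L₁ * L₂
          ≤⟨ +-mono-≤ (*-monoˡ-≤ L₁ (2^*leibniz≤ k i (suc j) (subst (_< n) e₂ i+j+k<n)))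
                      (*-monoˡ-≤ L₂ (2^*leibniz≤ k (suc i) j (subst (_< n) (+-suc (i + j) k) i+j+k<n))) ⟩
        Q * L₁ + Q * L₂                          ≡⟨ *-distribˡ-+ Q L₁ L₂ ⟨
        Q * (L₁ + L₂)                            ∎)
      where
      open ≤-Reasoning
      L  = leibniz i j
      L₁ = leibniz (suc i) j
      L₂ = leibniz i (suc j)
      L₁+L₂≢0 = >-nonZero (≤-trans (>-nonZero⁻¹ L₁ {{leibniz-nonZero (suc i) j}}) (m≤m+n L₁ L₂))
      l : ∀ t a b → 2 * t * (a * b) ≡ t * b * a + t * a * b
      l = solve-∀
      e₂ : i + j + suc k ≡ i + suc j + k
      e₂ = trans (+-suc (i + j) k) (cong (_+ k) (sym (+-suc i j)))

    -- The bound is read off at the apex, where `leibniz 0 0` is 1.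
    2^pred≤ : n ≥ 1 → 2 ^ pred n ≤ Q
    2^pred≤ n≥1 = subst (_≤ Q) (*-identityʳ _)
      (2^*leibniz≤ (pred n) 0 0 (≤-reflexive (suc-pred n {{>-nonZero n≥1}})))

  _-smooth_ : ℕ → ℕ → Set
  t -smooth m = ∀ {p} → Prime p → p ∣ m → p ≤ t

  prime-factor : ∀ m → m ≥ 2 → ∃ λ p → Prime p × p ∣ m
  prime-factor m m≥2 with factorise m {{>-nonZero (≤-trans (s≤s z≤n) m≥2)}}
  ... | record { factors = []     ; isFactorisation = m≡1 } = ⊥-elim (<-irrefl (sym m≡1) m≥2)
  ... | record { factors = p ∷ ps ; isFactorisation = eq ; factorsPrime = pp ∷ _ } =
    p , pp , subst (p ∣_) (sym eq) (m∣m*n _)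

  -- Stated for arbitrary `t ≥ 2`, because `smooth-multiple` strips every base from its bound down
  -- to 2, prime or composite.
  remove-factor : ∀ t → t ≥ 2 → ∀ m → m ≥ 1 →
                  ∃₂ λ v m′ → m ≡ t ^ v * m′ × m′ ≥ 1 × ¬ t ∣ m′
  remove-factor t t≥2 = <-rec _ go
    where
    go : ∀ m → (∀ {k} → k < m → k ≥ 1 → ∃₂ λ v m′ → k ≡ t ^ v * m′ × m′ ≥ 1 × ¬ t ∣ m′) →
         m ≥ 1 → ∃₂ λ v m′ → m ≡ t ^ v * m′ × m′ ≥ 1 × ¬ t ∣ m′
    go m rec m≥1 with t ∣? m
    ... | no t∤m = 0 , m , sym (*-identityˡ m) , m≥1 , t∤m
    ... | yes t∣m@(divides zero m≡0) = ⊥-elim (<-irrefl (sym m≡0) m≥1)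
    ... | yes (divides k@(suc _) m≡k*t)
      with rec (subst (k <_) (sym m≡k*t) (m<m*n k t t≥2)) (s≤s z≤n)
    ... | v , m′ , k≡ , m′≥1 , t∤m′ = suc v , m′ , eq , m′≥1 , t∤m′
      where
      open ≡-Reasoning
      eq : m ≡ t ^ suc v * m′
      eq = begin
        m               ≡⟨ m≡k*t ⟩
        k * t           ≡⟨ *-comm k t ⟩
        t * k           ≡⟨ cong (t *_) k≡ ⟩
        t * (t ^ v * m′) ≡⟨ *-assoc t (t ^ v) m′ ⟨
        t * t ^ v * m′  ∎

  ^-monoʳ-∣ : ∀ t {u v} → u ≤ v → t ^ u ∣ t ^ v
  ^-monoʳ-∣ t {u} {v} u≤v =
    subst (t ^ u ∣_) (trans (sym (^-distribˡ-+-* t u (v ∸ u))) (cong (t ^_) (m+[n∸m]≡n u≤v))) (m∣m*n _)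

  greatest-power : ∀ t → t ≥ 2 → ∀ N → N ≥ 1 → ∃ λ e → t ^ e ≤ N × N < t ^ suc e
  greatest-power t t≥2 N N≥1 =
    greatest-below (t ^_) N N≥1 N (<-≤-trans (n<2^n N) (^-monoˡ-≤ N t≥2))

  -- Q is the product, over 2 ≤ u ≤ t, of the largest power of u not exceeding N.
  smooth-multiple : ∀ N → N ≥ 1 → ∀ t → ∃ λ Q → Q ≥ 1 × Q ≤ N ^ t ×
                    (∀ {m} → m ≥ 1 → m ≤ N → t -smooth m → m ∣ Q)
  smooth-multiple N N≥1 zero = 1 , s≤s z≤n , s≤s z≤n , one
    where
    one : ∀ {m} → m ≥ 1 → m ≤ N → 0 -smooth m → m ∣ 1
    one {suc zero}    _ _ _  = ∣-refl
    one {suc (suc m)} _ _ sm with prime-factor (suc (suc m)) (s≤s (s≤s z≤n))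
    ... | p , pp , p∣m = ⊥-elim (<⇒≱ (>-nonZero⁻¹ p {{prime⇒nonZero pp}}) (sm pp p∣m))
  -- Powers of 1 never exceed `N`, so `greatest-power` starts at base 2. No prime is at most 1, so
  -- the multiple for `zero` serves again.
  smooth-multiple N N≥1 (suc zero) with smooth-multiple N N≥1 zero
  ... | Q , Q≥1 , Q≤ , ∣Q = Q , Q≥1 , ≤-trans Q≤ (≤-trans N≥1 (≤-reflexive (sym (*-identityʳ N)))) ,
    λ m≥1 m≤N sm → ∣Q m≥1 m≤N λ pp p∣m → ⊥-elim (<⇒≱ (nonTrivial⇒n>1 _ {{prime⇒nonTrivial pp}}) (sm pp p∣m))
  smooth-multiple N N≥1 t@(suc t′@(suc _))
    with smooth-multiple N N≥1 t′ | greatest-power t (s≤s (s≤s z≤n)) N N≥1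
  ... | Q , Q≥1 , Q≤ , ∣Q | e , t^e≤N , N<t^[1+e] =
    t ^ e * Q , *-mono-≤ (m^n>0 t e) Q≥1 , *-mono-≤ t^e≤N Q≤ , multiple
    where
    multiple : ∀ {m} → m ≥ 1 → m ≤ N → t -smooth m → m ∣ t ^ e * Q
    multiple {m} m≥1 m≤N sm with remove-factor t (s≤s (s≤s z≤n)) m m≥1
    ... | v , m′ , refl , m′≥1 , t∤m′ = *-pres-∣ (^-monoʳ-∣ t v≤e) (∣Q m′≥1 m′≤N sm′)
      where
      instance
        _ = >-nonZero m′≥1
        _ = m^n≢0 t v
      v≤e : v ≤ e
      v≤e = ≮⇒≥ λ e<v → <⇒≱ N<t^[1+e]
        (≤-trans (^-monoʳ-≤ t e<v) (≤-trans (m≤m*n (t ^ v) m′) m≤N))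
      m′≤N : m′ ≤ N
      m′≤N = ≤-trans (m≤n*m m′ (t ^ v)) m≤N
      -- A prime factor of `m′` is at most `t`, and equality would make `t` divide `m′`.
      sm′ : t′ -smooth m′
      sm′ {p} pp p∣m′ = s≤s⁻¹ (≤∧≢⇒< (sm pp (∣-trans p∣m′ (n∣m*n (t ^ v)))) λ { refl → t∤m′ p∣m′ })

  -- A finite search finds the prime or shows that every `m ≤ N` is `y`-smooth. In the latter case 2
  -- ^ (N - 1) ≤ Q ≤ N ^ y < 2 ^ (3 y²), whereas 3 y² < y³ = N because y ≥ 4.
  prime-between : ∀ y → y ≥ 4 → ∃ λ p → Prime p × y < p × p ≤ y ^ 3
  prime-between y y≥4 with anyUpTo? (λ p → prime? p ×-dec (y <? p)) (suc (y ^ 3))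
  ... | yes (p , p<1+N , pp , y<p) = p , pp , y<p , s≤s⁻¹ p<1+N
  ... | no none = ⊥-elim (<⇒≱ (≤-<-trans Q≤N^y N^y<2^) (2^pred≤ ∣Q N≥1))
    where
    N = y ^ 3
    instance
      _ = >-nonZero (≤-trans (s≤s z≤n) y≥4)
      _ = m^n≢0 y 3
    N≥1 : N ≥ 1
    N≥1 = m^n>0 y 3
    Q∃ = smooth-multiple N N≥1 y
    Q = proj₁ Q∃
    instance
      _ = >-nonZero (proj₁ (proj₂ Q∃))
    Q≤N^y = proj₁ (proj₂ (proj₂ Q∃))
    ∣Q : ∀ {m} → m ≥ 1 → m ≤ N → m ∣ Q
    ∣Q {m} m≥1 m≤N = proj₂ (proj₂ (proj₂ Q∃)) m≥1 m≤N λ {p} pp p∣m →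
      ≮⇒≥ λ y<p → none (p , s≤s (≤-trans (∣⇒≤ {{>-nonZero m≥1}} p∣m) m≤N) , pp , y<p)
    exponents : y * 3 * y < N
    exponents = begin-strict
      y * 3 * y     ≡⟨ *-assoc y 3 y ⟩
      y * (3 * y)   <⟨ *-monoʳ-< y (*-monoˡ-< y y≥4) ⟩
      y * (y * y)   ≡⟨ cong (λ z → y * (y * z)) (*-identityʳ y) ⟨
      N ∎
      where open ≤-Reasoning
    N^y<2^ : N ^ y < 2 ^ pred N
    N^y<2^ = begin-strict
      (y ^ 3) ^ y       <⟨ ^-monoˡ-< y (^-monoˡ-< 3 (n<2^n y)) ⟩
      ((2 ^ y) ^ 3) ^ y ≡⟨ cong (_^ y) (^-*-assoc 2 y 3) ⟩
      (2 ^ (y * 3)) ^ y ≡⟨ ^-*-assoc 2 (y * 3) y ⟩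
      2 ^ (y * 3 * y)   ≤⟨ ^-monoʳ-≤ 2 (<⇒≤pred exponents) ⟩
      2 ^ pred N ∎
      where open ≤-Reasoning

open PrimeGap using (prime-between)

-- Cardinalities of subsets of an initial segment

private variable q : ℕ

-- `allFin` is `tabulate id`, whose tail is not of that form. The induction therefore shrinks `X`
-- while `Y` stays fixed and `f` varies.
length-filter-tabulate : ∀ {r} (X : Subset q) (Y : Subset r) (f : Fin q → Fin r) →
  (∀ i → f i ∈ Y ⇔ i ∈ X) → length (filter (_∈? Y) (List.tabulate f)) ≡ ∣ X ∣
length-filter-tabulate [] Y f f∈ = refl
length-filter-tabulate (x ∷ X) Y f f∈
  with length-filter-tabulate X Y (f ∘ suc)
         (λ i → mk⇔ (drop-there ∘ Equivalence.to (f∈ (suc i))) (Equivalence.from (f∈ (suc i)) ∘ there))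
... | ih with f zero ∈? Y | x
... | yes f0∈ | true  = cong suc ih
... | no  f0∉ | false = ih
... | no  f0∉ | true  = ⊥-elim (f0∉ (Equivalence.from (f∈ zero) here))
... | yes f0∈ | false with () ← Equivalence.to (f∈ zero) f0∈

card-toℱ : (X : Subset q) → card (toℱ X) ≡ ∣ X ∣
card-toℱ {q} X = trans (List.length-map toℕ (filter (_∈? X) (List.allFin q)))
                       (length-filter-tabulate X X id λ i → mk⇔ id id)

module _ {P : Pred (Fin q) 0ℓ} (P? : Decidable P) where

  comprehension : Subset q
  comprehension = Vec.tabulate (does ∘ P?)

  ∈-comprehension⁺ : ∀ {x} → P x → x ∈ comprehension
  ∈-comprehension⁺ {x} px =
    Vec.lookup⇒[]= x comprehension (trans (Vec.lookup∘tabulate (does ∘ P?) x) (dec-true (P? x) px))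

  ∈-comprehension⁻ : ∀ {x} → x ∈ comprehension → P x
  ∈-comprehension⁻ {x} x∈ with P? x | trans (sym (Vec.lookup∘tabulate (does ∘ P?) x)) (Vec.[]=⇒lookup x∈)
  ... | yes px | _ = px

∣∪∣≤ : (A B : Subset q) → ∣ A ∪ B ∣ ≤ ∣ A ∣ + ∣ B ∣
∣∪∣≤ []          []          = z≤n
∣∪∣≤ (false ∷ A) (false ∷ B) = ∣∪∣≤ A B
∣∪∣≤ (false ∷ A) (true  ∷ B) = ≤-trans (s≤s (∣∪∣≤ A B)) (≤-reflexive (sym (+-suc ∣ A ∣ ∣ B ∣)))
∣∪∣≤ (true  ∷ A) (false ∷ B) = s≤s (∣∪∣≤ A B)
∣∪∣≤ (true  ∷ A) (true  ∷ B) = s≤s (≤-trans (∣∪∣≤ A B) (+-monoʳ-≤ ∣ A ∣ (n≤1+n ∣ B ∣)))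

∣∪∣-disjoint : (A B : Subset q) → (∀ {x} → x ∈ A → x ∉ B) → ∣ A ∪ B ∣ ≡ ∣ A ∣ + ∣ B ∣
∣∪∣-disjoint []          []          dis = refl
∣∪∣-disjoint (a ∷ A) (b ∷ B) dis
  with ∣∪∣-disjoint A B (λ x∈A x∈B → dis (there x∈A) (there x∈B))
∣∪∣-disjoint (false ∷ A) (false ∷ B) dis | ih = ih
∣∪∣-disjoint (false ∷ A) (true  ∷ B) dis | ih = trans (cong suc ih) (sym (+-suc ∣ A ∣ ∣ B ∣))
∣∪∣-disjoint (true  ∷ A) (false ∷ B) dis | ih = cong suc ih
∣∪∣-disjoint (true  ∷ A) (true  ∷ B) dis | ih = ⊥-elim (dis here here)

∣∣-partition : (X A B : Subset q) → (∀ {x} → x ∈ X → x ∈ A ⊎ x ∈ B) → A ⊆ X → B ⊆ X →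
               (∀ {x} → x ∈ A → x ∉ B) → ∣ X ∣ ≡ ∣ A ∣ + ∣ B ∣
∣∣-partition X A B cover A⊆X B⊆X dis =
  trans (cong ∣_∣ (⊆-antisym (x∈p∪q⁺ ∘ cover) ([ A⊆X , B⊆X ] ∘ x∈p∪q⁻ A B))) (∣∪∣-disjoint A B dis)

∃-⊆-size : (X : Subset q) → ∀ {k} → k ≤ ∣ X ∣ → ∃ λ A → A ⊆ X × ∣ A ∣ ≡ k
∃-⊆-size {q} X {zero} _ = ∅ , ⊥-elim ∘ ∉⊥ , ∣⊥∣≡0 q
∃-⊆-size (false ∷ X) {suc k} k≤ with ∃-⊆-size X k≤
... | A , A⊆X , ∣A∣ = false ∷ A , s⊆s A⊆X , ∣A∣
∃-⊆-size (true  ∷ X) {suc k} (s≤s k≤) with ∃-⊆-size X k≤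
... | A , A⊆X , ∣A∣ = true ∷ A , s⊆s A⊆X , cong suc ∣A∣

-- For `k = 1` this yields the maximum of a set, for `k = g` the last block of a cut.
∃-final-segment : (X : Subset q) → ∀ {k} → 1 ≤ k → k ≤ ∣ X ∣ → ∃₂ λ m A → m ∈ X × ∣ A ∣ ≡ k ×
                  (∀ {x} → x ∈ A → x ∈ X × ¬ x Fin.< m) × (∀ {x} → x ∈ X → ¬ x Fin.< m → x ∈ A)
∃-final-segment []      1≤k k≤ = ⊥-elim (<⇒≱ 1≤k k≤)
∃-final-segment (b ∷ X) {k} 1≤k k≤ with k ≤? ∣ X ∣
... | yes k≤∣X∣ with ∃-final-segment X 1≤k k≤∣X∣
... | m , A , m∈X , ∣A∣ , A⁻ , A⁺ = suc m , false ∷ A , there m∈X , ∣A∣ ,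
  (λ { (there x∈) → there (proj₁ (A⁻ x∈)) , proj₂ (A⁻ x∈) ∘ s≤s⁻¹ }) ,
  (λ { here x≮ → ⊥-elim (x≮ (s≤s z≤n)) ; (there x∈) x≮ → there (A⁺ x∈ (x≮ ∘ s≤s)) })
∃-final-segment (false ∷ X) 1≤k k≤ | no k≰ = ⊥-elim (k≰ k≤)
∃-final-segment (true ∷ X)  1≤k k≤ | no k≰ =
  zero , true ∷ X , here , ≤-antisym (≰⇒> k≰) k≤ , (λ x∈ → x∈ , λ ()) , λ x∈ _ → x∈

maximum : (M : Subset q) → Nonempty M → ∃ λ m → m ∈ M × (∀ {x} → x ∈ M → x Fin.≤ m)
maximum M (x , x∈M) with ∃-final-segment M {1} ≤-refl (≤-trans (s≤s z≤n) (x∈p⇒∣p-x∣<∣p∣ x∈M))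
-- An element y > m of `M` would lie in `A` together with m, but `A` has a single element.
... | m , A , m∈M , ∣A∣≡1 , A⁻ , A⁺ = m , m∈M , λ {y} y∈M → ≮⇒≥ λ m<y → <⇒≱
  (≤-trans (s≤s (≤-trans (s≤s z≤n) (x∈p⇒∣p-x∣<∣p∣ (x∈p∧x≢y⇒x∈p-y (A⁺ m∈M (<-irrefl refl)) (Fin.<⇒≢ m<y)))))
           (x∈p⇒∣p-x∣<∣p∣ (A⁺ y∈M (<-asym m<y))))
  (≤-reflexive ∣A∣≡1)

-- Cutting a set into blocks of equal size

IsBlock : Subset q → Subset q → Fin q → Subset q → Set
IsBlock X M m K = ∀ x →
  (x ∈ K → x ∈ X × ¬ x Fin.< m × (∀ m′ → m′ ∈ M → m Fin.< m′ → x Fin.< m′)) ×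
  (x ∈ X × ¬ x Fin.< m × (∀ m′ → m′ ∈ M → m Fin.< m′ → x Fin.< m′) → x ∈ K)

-- Like `IsBlock`, this is a pair of implications at each point, the form to which `Sat` unfolds on
-- `⇔ᶠ`. Proofs of satisfaction are thus proofs of these predicates.
IsRemainder : Subset q → Subset q → Subset q → Set
IsRemainder X M B = ∀ x → (x ∈ B → x ∈ X × (∀ m → m ∈ M → x Fin.< m)) ×
                          (x ∈ X × (∀ m → m ∈ M → x Fin.< m) → x ∈ B)

-- The elements of M cut X into consecutive blocks of size g, each starting at
-- an element of M; B is the part of X before the first cut.
Chunked : ℕ → Subset q → Subset q → Subset q → Set
Chunked g X M B = (∀ m → m ∈ M → ∃ λ K → IsBlock X M m K × ∣ K ∣ ≡ g) × IsRemainder X M B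

_<[_] : Subset q → Fin q → Subset q
X <[ m ] = comprehension (λ x → x ∈? X ×-dec x Fin.<? m)

∈-<[]⁺ : ∀ {X : Subset q} {m x} → x ∈ X → x Fin.< m → x ∈ X <[ m ]
∈-<[]⁺ {X = X} {m} x∈ x<m = ∈-comprehension⁺ (λ x → x ∈? X ×-dec x Fin.<? m) (x∈ , x<m)

∈-<[]⁻ : ∀ (X : Subset q) m {x} → x ∈ X <[ m ] → x ∈ X × x Fin.< m
∈-<[]⁻ X m = ∈-comprehension⁻ (λ x → x ∈? X ×-dec x Fin.<? m)

∣∣-cut : (X K : Subset q) (m : Fin q) → (∀ {x} → x ∈ K → x ∈ X × ¬ x Fin.< m) →
         (∀ {x} → x ∈ X → ¬ x Fin.< m → x ∈ K) → ∣ X ∣ ≡ ∣ X <[ m ] ∣ + ∣ K ∣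
∣∣-cut X K m K⁻ K⁺ = ∣∣-partition X (X <[ m ]) K cover (proj₁ ∘ ∈-<[]⁻ X m) (proj₁ ∘ K⁻)
  (λ x∈ x∈K → proj₂ (K⁻ x∈K) (proj₂ (∈-<[]⁻ X m x∈)))
  where
  cover : ∀ {x} → x ∈ X → x ∈ X <[ m ] ⊎ x ∈ K
  cover {x} x∈X with x Fin.<? m
  ... | yes x<m = inj₁ (∈-<[]⁺ x∈X x<m)
  ... | no  x≮m = inj₂ (K⁺ x∈X x≮m)

-- Induction on |M|. The block at the largest cut m is all of `X` from m on. Removing it, and m from
-- `M`, leaves a chunked set with the same remainder.
∣Chunked∣ : ∀ {g} (X M B : Subset q) → Chunked g X M B → ∣ X ∣ ≡ g * ∣ M ∣ + ∣ B ∣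
∣Chunked∣ {q} {g} X M B = go ∣ M ∣ X M refl
  where
  go : ∀ k (X M : Subset q) → ∣ M ∣ ≡ k → Chunked g X M B → ∣ X ∣ ≡ g * k + ∣ B ∣
  go k X M ∣M∣ (blocks , rem) with nonempty? M
  go zero X M ∣M∣ (blocks , rem) | no empty = trans
    (cong ∣_∣ (⊆-antisym (λ {x} x∈X → proj₂ (rem x) (x∈X , λ m m∈M → ⊥-elim (empty (m , m∈M))))
                         (λ {x} x∈B → proj₁ (proj₁ (rem x) x∈B))))
    (cong (_+ ∣ B ∣) (sym (*-zeroʳ g)))
  go (suc k) X M ∣M∣ (blocks , rem) | no empty =
    ⊥-elim (0≢1+n (trans (sym (trans (cong ∣_∣ (Empty-unique empty)) (∣⊥∣≡0 q))) ∣M∣))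
  go zero X M ∣M∣ (blocks , rem) | yes (x , x∈M) =
    ⊥-elim (n≮0 (subst (∣ M - x ∣ <_) ∣M∣ (x∈p⇒∣p-x∣<∣p∣ x∈M)))
  go (suc k) X M ∣M∣ (blocks , rem) | yes ne with maximum M ne
  ... | m , m∈M , m-max with blocks m m∈M
  ... | K , K-block , ∣K∣≡g = begin
    ∣ X ∣                     ≡⟨ ∣∣-cut X K m
      (λ {x} x∈K → let x∈X , x≮m , _ = proj₁ (K-block x) x∈K in x∈X , x≮m)
      (λ {x} x∈X x≮m → proj₂ (K-block x)
        (x∈X , x≮m , λ m′ m′∈M m<m′ → ⊥-elim (<⇒≱ m<m′ (m-max m′∈M)))) ⟩
    ∣ X <[ m ] ∣ + ∣ K ∣      ≡⟨ cong₂ _+_ (go k (X <[ m ]) (M <[ m ]) ∣M<m∣ (blocks′ , rem′)) ∣K∣≡g ⟩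
    g * k + ∣ B ∣ + g         ≡⟨ arith g k ∣ B ∣ ⟩
    g * suc k + ∣ B ∣         ∎
    where
    open ≡-Reasoning
    arith : ∀ g k b → g * k + b + g ≡ g * suc k + b
    arith = solve-∀
    ∣M<m∣ : ∣ M <[ m ] ∣ ≡ k
    ∣M<m∣ = suc-injective (begin
      suc ∣ M <[ m ] ∣            ≡⟨ +-comm 1 _ ⟩
      ∣ M <[ m ] ∣ + 1            ≡⟨ cong (∣ M <[ m ] ∣ +_) (∣⁅x⁆∣≡1 m) ⟨
      ∣ M <[ m ] ∣ + ∣ ⁅ m ⁆ ∣    ≡⟨ ∣∣-cut M ⁅ m ⁆ m
        (λ x∈ → subst (λ y → y ∈ M × ¬ y Fin.< m) (sym (x∈⁅y⁆⇒x≡y m x∈)) (m∈M , <-irrefl refl))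
        (λ x∈M x≮m → subst (_∈ ⁅ m ⁆) (Fin.≤-antisym (≮⇒≥ x≮m) (m-max x∈M)) (x∈⁅x⁆ m)) ⟨
      ∣ M ∣                       ≡⟨ ∣M∣ ⟩
      suc k                       ∎)
    -- Since x < m, a bound by the cuts below m holds at all cuts, the others being at least m. `P`
    -- selects the cuts concerned: those after m′ for a block, all of them for the remainder.
    extend : ∀ {x} (P : Fin q → Set) → x Fin.< m →
             (∀ m′ → m′ ∈ M <[ m ] → P m′ → x Fin.< m′) → ∀ m′ → m′ ∈ M → P m′ → x Fin.< m′
    extend P x<m below m′ m′∈M pm′ with m′ Fin.<? m
    ... | yes m′<m = below m′ (∈-<[]⁺ m′∈M m′<m) pm′
    ... | no  m′≮m = <-≤-trans x<m (≮⇒≥ m′≮m)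
    blocks′ : ∀ m′ → m′ ∈ M <[ m ] → ∃ λ K → IsBlock (X <[ m ]) (M <[ m ]) m′ K × ∣ K ∣ ≡ g
    blocks′ m′ m′∈ with ∈-<[]⁻ M m m′∈
    ... | m′∈M , m′<m with blocks m′ m′∈M
    ... | K , K-block , ∣K∣≡g = K , (λ x →
      (λ x∈K → let x∈X , x≮m′ , next = proj₁ (K-block x) x∈K in
         ∈-<[]⁺ x∈X (next m m∈M m′<m) , x≮m′ , λ m″ m″∈ → next m″ (proj₁ (∈-<[]⁻ M m m″∈))) ,
      (λ (x∈ , x≮m′ , next) → let x∈X , x<m = ∈-<[]⁻ X m x∈ in
         proj₂ (K-block x) (x∈X , x≮m′ , extend (m′ Fin.<_) x<m next))) , ∣K∣≡g
    rem′ : IsRemainder (X <[ m ]) (M <[ m ]) B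
    rem′ x =
      (λ x∈B → let x∈X , next = proj₁ (rem x) x∈B in
         ∈-<[]⁺ x∈X (next m m∈M) , λ m′ m′∈ → next m′ (proj₁ (∈-<[]⁻ M m m′∈))) ,
      (λ (x∈ , next) → let x∈X , x<m = ∈-<[]⁻ X m x∈ in
         proj₂ (rem x) (x∈X , λ m′ m′∈M → extend (λ _ → Unit.⊤) x<m (λ m″ m″∈ _ → next m″ m″∈) m′ m′∈M _))

-- Blocks are split off from the top as long as `g` elements are left. `M ⊆ X` is carried along
-- because it places the cuts of the rest below the new cut.
∃-Chunked : ∀ {g} → 1 ≤ g → (X : Subset q) → ∃₂ λ M B → M ⊆ X × ∣ B ∣ < g × Chunked g X M B
∃-Chunked {q} {g} 1≤g X = go ∣ X ∣ X ≤-refl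
  where
  go : ∀ k (X : Subset q) → ∣ X ∣ ≤ k → ∃₂ λ M B → M ⊆ X × ∣ B ∣ < g × Chunked g X M B
  go k X ∣X∣≤k with g ≤? ∣ X ∣
  ... | no g≰ = ∅ , X , ⊥-elim ∘ ∉⊥ , ≰⇒> g≰ , (λ m m∈ → ⊥-elim (∉⊥ m∈)) ,
    λ x → (λ x∈X → x∈X , λ m m∈ → ⊥-elim (∉⊥ m∈)) , proj₁
  go zero X ∣X∣≤k | yes g≤ = ⊥-elim (<⇒≱ 1≤g (≤-trans g≤ ∣X∣≤k))
  go (suc k) X ∣X∣≤k | yes g≤ with ∃-final-segment X 1≤g g≤
  ... | m , K , m∈X , ∣K∣ , K⁻ , K⁺
    with go k (X <[ m ]) (s≤s⁻¹ (≤-trans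
           (subst (_< ∣ X ∣) (+-identityʳ _) (subst (∣ X <[ m ] ∣ + 0 <_) (sym (∣∣-cut X K m K⁻ K⁺))
             (+-monoʳ-< ∣ X <[ m ] ∣ (subst (1 ≤_) (sym ∣K∣) 1≤g)))) ∣X∣≤k))
  ... | M , B , M⊆ , ∣B∣<g , blocks , rem = M ∪ ⁅ m ⁆ , B , M∪⊆ , ∣B∣<g , blocks′ , rem′
    where
    M<m : ∀ {m′} → m′ ∈ M → m′ Fin.< m
    M<m m′∈M = proj₂ (∈-<[]⁻ X m (M⊆ m′∈M))
    m∈ : m ∈ M ∪ ⁅ m ⁆
    m∈ = q⊆p∪q M _ (x∈⁅x⁆ m)
    split : ∀ {m′} → m′ ∈ M ∪ ⁅ m ⁆ → m′ ∈ M ⊎ m′ ≡ m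
    split m′∈ with x∈p∪q⁻ M ⁅ m ⁆ m′∈
    ... | inj₁ m′∈M  = inj₁ m′∈M
    ... | inj₂ m′∈⁅⁆ = inj₂ (x∈⁅y⁆⇒x≡y m m′∈⁅⁆)
    M∪⊆ : M ∪ ⁅ m ⁆ ⊆ X
    M∪⊆ m′∈ with split m′∈
    ... | inj₁ m′∈M = proj₁ (∈-<[]⁻ X m (M⊆ m′∈M))
    ... | inj₂ refl = m∈X
    blocks′ : ∀ m′ → m′ ∈ M ∪ ⁅ m ⁆ → ∃ λ K → IsBlock X (M ∪ ⁅ m ⁆) m′ K × ∣ K ∣ ≡ g
    blocks′ m′ m′∈ with split m′∈
    ... | inj₂ refl = K , (λ x →
      (λ x∈K → let x∈X , x≮m = K⁻ x∈K in x∈X , x≮m , λ m″ m″∈ m<m″ →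
         ⊥-elim ([ (λ m″∈M → <-asym m<m″ (M<m m″∈M)) , (λ { refl → <-irrefl refl m<m″ }) ] (split m″∈))) ,
      (λ (x∈X , x≮m , _) → K⁺ x∈X x≮m)) , ∣K∣
    ... | inj₁ m′∈M with blocks m′ m′∈M
    ... | K′ , K′-block , ∣K′∣ = K′ , (λ x →
      (λ x∈K′ → let x∈ , x≮m′ , next = proj₁ (K′-block x) x∈K′
                    x∈X , x<m = ∈-<[]⁻ X m x∈ in
         x∈X , x≮m′ , λ m″ m″∈ m′<m″ → [ (λ m″∈M → next m″ m″∈M m′<m″) , (λ { refl → x<m }) ] (split m″∈)) ,
      (λ (x∈X , x≮m′ , next) → proj₂ (K′-block x)
         (∈-<[]⁺ x∈X (next m m∈ (M<m m′∈M)) , x≮m′ , λ m″ m″∈M → next m″ (p⊆p∪q _ m″∈M)))) , ∣K′∣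
    rem′ : IsRemainder X (M ∪ ⁅ m ⁆) B
    rem′ x =
      (λ x∈B → let x∈ , next = proj₁ (rem x) x∈B
                   x∈X , x<m = ∈-<[]⁻ X m x∈ in
         x∈X , λ m′ m′∈ → [ next m′ , (λ { refl → x<m }) ] (split m′∈)) ,
      (λ (x∈X , next) → proj₂ (rem x) (∈-<[]⁺ x∈X (next m m∈) , λ m′ m′∈M → next m′ (p⊆p∪q _ m′∈M)))

-- Initial segments, intervals and removal of one element

IsInitial : ℕ → Subset q → Set
IsInitial n A = ∀ x → (x ∈ A → toℕ x < n) × (toℕ x < n → x ∈ A)

∣IsInitial∣ : ∀ (A : Subset q) {n} → n ≤ q → IsInitial n A → ∣ A ∣ ≡ n
∣IsInitial∣ []          z≤n       A-init = refl
∣IsInitial∣ (true ∷ A)  z≤n       A-init with () ← proj₁ (A-init zero) here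
∣IsInitial∣ (false ∷ A) z≤n       A-init =
  ∣IsInitial∣ A z≤n λ x → (λ x∈ → ⊥-elim (n≮0 (proj₁ (A-init (suc x)) (there x∈)))) , λ ()
∣IsInitial∣ (true ∷ A)  (s≤s n≤q) A-init = cong suc (∣IsInitial∣ A n≤q λ x →
  (λ x∈ → s≤s⁻¹ (proj₁ (A-init (suc x)) (there x∈))) , λ x< → drop-there (proj₂ (A-init (suc x)) (s≤s x<)))
∣IsInitial∣ (false ∷ A) (s≤s n≤q) A-init with () ← proj₂ (A-init zero) (s≤s z≤n)

∣IsInitial-toℕ∣ : ∀ (x : Fin q) {A} → IsInitial (toℕ x) A → ∣ A ∣ ≡ toℕ x
∣IsInitial-toℕ∣ x {A} = ∣IsInitial∣ A (<⇒≤ (Fin.toℕ<n x))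

initial : ℕ → Subset q
initial n = comprehension (λ x → toℕ x <? n)

initial-IsInitial : ∀ n → IsInitial {q} n (initial n)
initial-IsInitial n x = ∈-comprehension⁻ (λ x → toℕ x <? n) , ∈-comprehension⁺ (λ x → toℕ x <? n)

∣Empty∣ : {X : Subset q} → Empty X → ∣ X ∣ ≡ 0
∣Empty∣ {q} empty = trans (cong ∣_∣ (Empty-unique empty)) (∣⊥∣≡0 q)

∣∣>0⇒Nonempty : {X : Subset q} → ∣ X ∣ > 0 → Nonempty X
∣∣>0⇒Nonempty {X = X} ∣X∣>0 with nonempty? X
... | yes nonempty = nonempty
... | no  empty    = ⊥-elim (<⇒≱ ∣X∣>0 (≤-reflexive (∣Empty∣ empty)))

-- `K` is `X` without one element x. The condition y ≠ x is written with `<`, as in the formula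
-- language.
IsPredecessor : Subset q → Subset q → Set
IsPredecessor X K = ∃ λ x → x ∈ X × ∀ y →
  (y ∈ K → y ∈ X × (y Fin.< x ⊎ x Fin.< y)) × (y ∈ X × (y Fin.< x ⊎ x Fin.< y) → y ∈ K)

∣IsPredecessor∣ : (X K : Subset q) → IsPredecessor X K → ∣ X ∣ ≡ suc ∣ K ∣
∣IsPredecessor∣ X K (x , x∈X , K-spec) = trans
  (∣∣-partition X ⁅ x ⁆ K cover
    (λ y∈ → subst (_∈ X) (sym (x∈⁅y⁆⇒x≡y x y∈)) x∈X)
    (λ {y} → proj₁ ∘ proj₁ (K-spec y))
    (λ {y} y∈ y∈K → [ <-irrefl (cong toℕ (x∈⁅y⁆⇒x≡y x y∈)) , <-irrefl (cong toℕ (sym (x∈⁅y⁆⇒x≡y x y∈))) ]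
                      (proj₂ (proj₁ (K-spec y) y∈K))))
  (cong (_+ ∣ K ∣) (∣⁅x⁆∣≡1 x))
  where
  cover : ∀ {y} → y ∈ X → y ∈ ⁅ x ⁆ ⊎ y ∈ K
  cover {y} y∈X with <-cmp (toℕ y) (toℕ x)
  ... | tri< y<x _ _ = inj₂ (proj₂ (K-spec y) (y∈X , inj₁ y<x))
  ... | tri≈ _ y≡x _ = inj₁ (subst (_∈ ⁅ x ⁆) (sym (Fin.toℕ-injective y≡x)) (x∈⁅x⁆ x))
  ... | tri> _ _ x<y = inj₂ (proj₂ (K-spec y) (y∈X , inj₂ x<y))

∃-predecessor : (X : Subset q) → Nonempty X → ∃ λ K → IsPredecessor X K
∃-predecessor {q} X (x , x∈X) = comprehension P? , x , x∈X , λ y → ∈-comprehension⁻ P? , ∈-comprehension⁺ P?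
  where
  P? : Decidable (λ y → y ∈ X × (y Fin.< x ⊎ x Fin.< y))
  P? y = y ∈? X ×-dec (y Fin.<? x ⊎-dec x Fin.<? y)

IsInterval : ℕ → ℕ → Subset q → Set
IsInterval a b B = ∀ x → (x ∈ B → toℕ x < b × ¬ toℕ x < a) × (toℕ x < b × ¬ toℕ x < a → x ∈ B)

-- The segment [0,z) is cut at x; as x ≤ z, its lower part is [0,x).
∣IsInterval∣ : ∀ (B : Subset q) (x z : Fin q) → ¬ z Fin.< x → IsInterval (toℕ x) (toℕ z) B →
               toℕ x + ∣ B ∣ ≡ toℕ z
∣IsInterval∣ B x z z≮x B-spec = begin
  toℕ x + ∣ B ∣          ≡⟨ cong (_+ ∣ B ∣) (∣IsInitial∣ (Z <[ x ]) (<⇒≤ (Fin.toℕ<n x)) Z<x-initial) ⟨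
  ∣ Z <[ x ] ∣ + ∣ B ∣   ≡⟨ ∣∣-cut Z B x
                            (λ {u} u∈B → let u<z , u≮x = proj₁ (B-spec u) u∈B in proj₂ (Z-initial u) u<z , u≮x)
                            (λ {u} u∈Z u≮x → proj₂ (B-spec u) (proj₁ (Z-initial u) u∈Z , u≮x)) ⟨
  ∣ Z ∣                  ≡⟨ ∣IsInitial∣ Z (<⇒≤ (Fin.toℕ<n z)) Z-initial ⟩
  toℕ z                  ∎
  where
  open ≡-Reasoning
  Z = initial (toℕ z)
  Z-initial = initial-IsInitial (toℕ z)
  Z<x-initial : IsInitial (toℕ x) (Z <[ x ])
  Z<x-initial u = (λ u∈ → proj₂ (∈-<[]⁻ Z x u∈)) ,
                  λ u<x → ∈-<[]⁺ (proj₂ (Z-initial u) (<-≤-trans u<x (≮⇒≥ z≮x))) u<x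

interval : ℕ → ℕ → Subset q
interval a b = comprehension (λ x → toℕ x <? b ×-dec ¬? (toℕ x <? a))

interval-IsInterval : ∀ a b → IsInterval {q} a b (interval a b)
interval-IsInterval a b x = ∈-comprehension⁻ P? , ∈-comprehension⁺ P?
  where
  P? : Decidable (λ x → toℕ x < b × ¬ toℕ x < a)
  P? x = toℕ x <? b ×-dec ¬? (toℕ x <? a)

-- Formulas

infix 3 _⇔ᶠ_
_⇔ᶠ_ : ∀ {m n} → MSO m n → MSO m n → MSO m n
φ ⇔ᶠ ψ = (φ ⇒ᶠ ψ) ∧ᶠ (ψ ⇒ᶠ φ)

infix 7 _⊆ᶠ_
_⊆ᶠ_ : ∀ {m n} → Fin n → Fin n → MSO m n
i ⊆ᶠ j = ∀¹ (0F ∈ᶠ i ⇒ᶠ 0F ∈ᶠ j)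

nonemptyᶠ : ∀ {m n} → Fin n → MSO m n
nonemptyᶠ i = ∃¹ (0F ∈ᶠ i)

unionᶠ : ∀ {m n} → Fin n → Fin n → Fin n → MSO m n
unionᶠ w i j = ∀¹ (0F ∈ᶠ w ⇔ᶠ (0F ∈ᶠ i ∨ᶠ 0F ∈ᶠ j))

initialᶠ : ∀ {m n} → Fin m → Fin n → MSO m n
initialᶠ x i = ∀¹ (0F ∈ᶠ i ⇔ᶠ 0F <ᶠ suc x)

intervalᶠ : ∀ {m n} → Fin m → Fin m → Fin n → MSO m n
intervalᶠ x y i = ∀¹ (0F ∈ᶠ i ⇔ᶠ (0F <ᶠ suc y ∧ᶠ ¬ᶠ 0F <ᶠ suc x))

isZeroᶠ : ∀ {m n} → Fin m → MSO m n
isZeroᶠ x = ¬ᶠ ∃¹ (0F <ᶠ suc x)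

-- Innermost, 2F is a set Z disjoint from X and Y, and 1F and 0F are X ∪ Z and Y ∪ Z. The single
-- implication is aimed at refuting |X| < |Y|.
transferᶠ : ∀ {m n} → Fin n → Fin n → MSO m n
transferᶠ i j =
  ∀² (∀¹ (0F ∈ᶠ 0F ⇒ᶠ ¬ᶠ 0F ∈ᶠ suc i ∧ᶠ ¬ᶠ 0F ∈ᶠ suc j) ⇒ᶠ
      ∃² (∃² (unionᶠ 1F (suc (suc (suc i))) 2F ∧ᶠ unionᶠ 0F (suc (suc (suc j))) 2F ∧ᶠ (Rᶠ 1F ⇒ᶠ Rᶠ 0F))))

-- transferᶠ alone separates X and Y only if both are small.  Here Y suffices: if
-- X is larger than Y, then some X′ ⊆ X with |Y| + 1 elements is still small.
embedᶠ : ∀ {m n} → Fin n → Fin n → MSO m n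
embedᶠ i j = ∀² (0F ⊆ᶠ suc i ⇒ᶠ ∃² (0F ⊆ᶠ suc (suc j) ∧ᶠ transferᶠ 0F 1F))

-- Satisfied when Chunked holds, with blocks K for which φ asserts |K| = |g|.
chunkedᶠ : (∀ {m n} → Fin n → Fin n → Fin n → MSO m n) →
           ∀ {m n} → Fin n → Fin n → Fin n → Fin n → MSO m n
chunkedᶠ φ g i M B =
  ∀¹ (0F ∈ᶠ M ⇒ᶠ
      ∃² (∀¹ (0F ∈ᶠ 0F ⇔ᶠ (0F ∈ᶠ suc i ∧ᶠ ¬ᶠ 0F <ᶠ 1F ∧ᶠ
                             ∀¹ (0F ∈ᶠ suc M ⇒ᶠ 2F <ᶠ 0F ⇒ᶠ 1F <ᶠ 0F))) ∧ᶠ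
          φ (suc g) 0F (suc g))) ∧ᶠ
  ∀¹ (0F ∈ᶠ B ⇔ᶠ (0F ∈ᶠ i ∧ᶠ ∀¹ (0F ∈ᶠ M ⇒ᶠ 1F <ᶠ 0F)))

5↑_ : ∀ {n} → Fin n → Fin (5 + n)
5↑ i = suc (suc (suc (suc (suc i))))

-- Compares i and j through the digits of their cardinalities: both are cut into
-- blocks of size |g|, and the numbers of blocks, which are smaller by a factor
-- |g|, and the remainders are compared.  The variables 4F and 3F are the cuts,
-- 2F and 1F the remainders, and 0F is a subset of g which bounds the remainders.
refineᶠ : ℕ → ∀ {m n} → Fin n → Fin n → Fin n → MSO m n
refineᶠ zero    g i j = embedᶠ i j ∧ᶠ embedᶠ j i
refineᶠ (suc k) g i j =
  ∃² (∃² (∃² (∃² (∃² (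
    chunkedᶠ (refineᶠ k) (5↑ g) (5↑ i) 4F 2F ∧ᶠ
    chunkedᶠ (refineᶠ k) (5↑ g) (5↑ j) 3F 1F ∧ᶠ
    refineᶠ k (5↑ g) 4F 3F ∧ᶠ
    0F ⊆ᶠ 5↑ g ∧ᶠ refineᶠ k (5↑ g) 2F 0F ∧ᶠ refineᶠ k (5↑ g) 1F 0F)))))

predecessorᶠ : ∀ {m n} → Fin n → Fin n → MSO m n
predecessorᶠ k i = ∃¹ (0F ∈ᶠ i ∧ᶠ ∀¹ (0F ∈ᶠ k ⇔ᶠ (0F ∈ᶠ i ∧ᶠ (0F <ᶠ 1F ∨ᶠ 1F <ᶠ 0F))))

-- Removes elements from both sets in step, which is exact for sets of fewer than `k` elements and
-- serves the small `q`. At `zero` it is a tautology, so that it holds for all pairs of equal size.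
boundedᶠ : ℕ → ∀ {m n} → Fin n → Fin n → MSO m n
boundedᶠ zero    i j = i ⊆ᶠ i
boundedᶠ (suc k) i j =
  (¬ᶠ nonemptyᶠ i ∧ᶠ ¬ᶠ nonemptyᶠ j) ∨ᶠ
  ∃² (∃² (predecessorᶠ 1F (suc (suc i)) ∧ᶠ predecessorᶠ 0F (suc (suc j)) ∧ᶠ boundedᶠ k 1F 0F))

-- Completeness and soundness of the formulas

Sat′ : ∀ q {m n} → MSO m n → Vec (Fin q) m → Vec (Subset q) n → Set
Sat′ = Sat PrimeCard

module _ {q : ℕ} where

  transfer-complete : ∀ {m n} (xs : Vec (Fin q) m) (Xs : Vec (Subset q) n) i j →
    ∣ lookup Xs i ∣ ≡ ∣ lookup Xs j ∣ → Sat′ q (transferᶠ i j) xs Xs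
  transfer-complete xs Xs i j eq Z Z-dis =
    X ∪ Z , Y ∪ Z , (λ x → x∈p∪q⁻ X Z , x∈p∪q⁺) , (λ x → x∈p∪q⁻ Y Z , x∈p∪q⁺) ,
    subst Prime (begin
      card (toℱ (X ∪ Z))   ≡⟨ card-toℱ (X ∪ Z) ⟩
      ∣ X ∪ Z ∣            ≡⟨ ∣∪∣-disjoint X Z (λ x∈X x∈Z → proj₁ (Z-dis _ x∈Z) x∈X) ⟩
      ∣ X ∣ + ∣ Z ∣        ≡⟨ cong (_+ ∣ Z ∣) eq ⟩
      ∣ Y ∣ + ∣ Z ∣        ≡⟨ ∣∪∣-disjoint Y Z (λ x∈Y x∈Z → proj₂ (Z-dis _ x∈Z) x∈Y) ⟨
      ∣ Y ∪ Z ∣            ≡⟨ card-toℱ (Y ∪ Z) ⟨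
      card (toℱ (Y ∪ Z))   ∎)
    where
    open ≡-Reasoning
    X = lookup Xs i
    Y = lookup Xs j

  -- The bound leaves room for `k` elements outside X ∪ Y, which form the set Z of the formula.
  transfer-prime : ∀ {m n} (xs : Vec (Fin q) m) (Xs : Vec (Subset q) n) i j →
    Sat′ q (transferᶠ i j) xs Xs → ∀ k → k + ∣ lookup Xs i ∪ lookup Xs j ∣ ≤ q →
    Prime (∣ lookup Xs i ∣ + k) → Prime (∣ lookup Xs j ∣ + k)
  transfer-prime xs Xs i j sat k k≤ pr
    with ∃-⊆-size (∁ (lookup Xs i ∪ lookup Xs j)) {k}
           (subst (k ≤_) (sym (∣∁p∣≡n∸∣p∣ (lookup Xs i ∪ lookup Xs j))) (m+n≤o⇒m≤o∸n k k≤))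
  ... | Z , Z⊆ , refl with sat Z (λ x x∈Z → (λ x∈X → x∈∁p⇒x∉p (Z⊆ x∈Z) (p⊆p∪q _ x∈X))
                                           , (λ x∈Y → x∈∁p⇒x∉p (Z⊆ x∈Z) (q⊆p∪q (lookup Xs i) _ x∈Y)))
  ... | W , W′ , W-union , W′-union , W⇒W′ =
    subst Prime (size W′ (lookup Xs j) W′-union λ x∈Y x∈Z → x∈∁p⇒x∉p (Z⊆ x∈Z) (q⊆p∪q (lookup Xs i) _ x∈Y))
      (W⇒W′ (subst Prime (sym (size W (lookup Xs i) W-union λ x∈X x∈Z → x∈∁p⇒x∉p (Z⊆ x∈Z) (p⊆p∪q _ x∈X))) pr))
    where
    size : ∀ W X → (∀ x → (x ∈ W → x ∈ X ⊎ x ∈ Z) × (x ∈ X ⊎ x ∈ Z → x ∈ W)) →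
           (∀ {x} → x ∈ X → x ∉ Z) → card (toℱ W) ≡ ∣ X ∣ + ∣ Z ∣
    size W X union dis = trans (card-toℱ W)
      (∣∣-partition W X Z (λ {x} → proj₁ (union x)) (λ {x} → proj₂ (union x) ∘ inj₁)
                          (λ {x} → proj₂ (union x) ∘ inj₂) dis)

  -- A prime p in (s, s³] would start an arithmetic progression of primes
  -- p, p + d, …, p + p d, where d is the difference of the two cardinalities.
  transfer-sound : ∀ {s m n} (xs : Vec (Fin q) m) (Xs : Vec (Subset q) n) i j →
    4 ≤ s → s ^ 5 ≤ q → ∣ lookup Xs j ∣ ≤ s →
    Sat′ q (transferᶠ i j) xs Xs → ¬ ∣ lookup Xs i ∣ < ∣ lookup Xs j ∣
  transfer-sound {s} xs Xs i j 4≤s s^5≤q b≤s sat a<b with prime-between s 4≤s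
  ... | p , pp , s<p , p≤s³
    -- The last term p + p d = (1 + d) p is divisible by p, which forces p = 1 or p d = 0.
    with prime⇒irreducible (progression p ≤-refl) (divides (suc d) (cong (p +_) (*-comm p d)))
    where
    a = ∣ lookup Xs i ∣
    b = ∣ lookup Xs j ∣
    d = b ∸ a
    a≤s = ≤-trans (<⇒≤ a<b) b≤s
    -- Each Z has at most p + p s elements and X ∪ Y at most 2 s, so all unions needed fit into
    -- [0,q).
    room : p + p * s + (s + s) ≤ q
    room = begin
      p + p * s + (s + s)         ≤⟨ +-mono-≤ (+-mono-≤ p≤s³ (*-monoˡ-≤ s p≤s³)) (+-mono-≤ s≤s³ s≤s³) ⟩
      s ^ 3 + s ^ 3 * s + (s ^ 3 + s ^ 3) ≡⟨ arith (s ^ 3) s ⟩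
      s ^ 3 * (3 + s)             ≤⟨ *-monoʳ-≤ (s ^ 3) (begin
         3 + s        ≤⟨ +-monoˡ-≤ s (≤-trans (n≤1+n 3) 4≤s) ⟩
         s + s        ≡⟨ arith′ s ⟩
         2 * s        ≤⟨ *-monoˡ-≤ s (≤-trans (s≤s (s≤s z≤n)) 4≤s) ⟩
         s * s        ∎) ⟩
      s ^ 3 * (s * s)             ≡⟨ arith″ s ⟩
      s ^ 5                       ≤⟨ s^5≤q ⟩
      q                           ∎
      where
      open ≤-Reasoning
      instance _ = >-nonZero (≤-trans (s≤s z≤n) 4≤s)
      s≤s³ : s ≤ s ^ 3
      s≤s³ = m≤m*n s (s ^ 2) {{m^n≢0 s 2}}
      arith : ∀ c s → c + c * s + (c + c) ≡ c * (3 + s)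
      arith = solve-∀
      arith′ : ∀ s → s + s ≡ 2 * s
      arith′ = solve-∀
      arith″ : ∀ s → s * (s * (s * 1)) * (s * s) ≡ s * (s * (s * (s * (s * 1))))
      arith″ = solve-∀
    progression : ∀ n → n ≤ p → Prime (p + n * d)
    progression zero    _   = subst Prime (sym (+-identityʳ p)) pp
    progression (suc n) n<p = subst Prime eq′ (transfer-prime xs Xs i j sat k k-room
      (subst Prime (sym a+k≡) (progression n (<⇒≤ n<p))))
      where
      k = p + n * d ∸ a
      a+k≡ : a + k ≡ p + n * d
      a+k≡ = m+[n∸m]≡n (≤-trans a≤s (≤-trans (<⇒≤ s<p) (m≤m+n p _)))
      eq′ : b + k ≡ p + suc n * d
      eq′ = begin
        b + k              ≡⟨ cong (_+ k) (m∸n+n≡m (<⇒≤ a<b)) ⟨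
        d + a + k          ≡⟨ +-assoc d a k ⟩
        d + (a + k)        ≡⟨ cong (d +_) a+k≡ ⟩
        d + (p + n * d)    ≡⟨ arith d p (n * d) ⟩
        p + (d + n * d)    ∎
        where
        open ≡-Reasoning
        arith : ∀ d p e → d + (p + e) ≡ p + (d + e)
        arith = solve-∀
      k-room : k + ∣ lookup Xs i ∪ lookup Xs j ∣ ≤ q
      k-room = ≤-trans (+-mono-≤
        (≤-trans (m∸n≤m (p + n * d) a) (+-monoʳ-≤ p (*-mono-≤ (<⇒≤ n<p) (≤-trans (m∸n≤m b a) b≤s))))
        (≤-trans (∣∪∣≤ (lookup Xs i) (lookup Xs j)) (+-mono-≤ a≤s b≤s))) room
  ... | inj₁ refl = ¬prime[1] pp
  ... | inj₂ p≡p+pd = <⇒≢ (m<m+n p (*-mono-≤ (≤-trans (s≤s z≤n) s<p) (m<n⇒0<n∸m a<b))) p≡p+pd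

  embed-complete : ∀ {m n} (xs : Vec (Fin q) m) (Xs : Vec (Subset q) n) i j →
    ∣ lookup Xs i ∣ ≡ ∣ lookup Xs j ∣ → Sat′ q (embedᶠ i j) xs Xs
  embed-complete xs Xs i j eq X′ X′⊆X
    with ∃-⊆-size (lookup Xs j) (subst (∣ X′ ∣ ≤_) eq (p⊆q⇒∣p∣≤∣q∣ (λ {x} → X′⊆X x)))
  ... | Y′ , Y′⊆Y , ∣Y′∣≡ = Y′ , (λ _ → Y′⊆Y) , transfer-complete xs (Y′ ∷ X′ ∷ Xs) 0F 1F ∣Y′∣≡

  embed-sound : ∀ {s m n} (xs : Vec (Fin q) m) (Xs : Vec (Subset q) n) i j →
    4 ≤ s → s ^ 5 ≤ q → ∣ lookup Xs j ∣ < s →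
    Sat′ q (embedᶠ i j) xs Xs → ∣ lookup Xs i ∣ ≤ ∣ lookup Xs j ∣
  embed-sound {s} xs Xs i j 4≤s s^5≤q ∣Y∣<s sat = ≮⇒≥ λ ∣Y∣<∣X∣ → impossible (∃-⊆-size (lookup Xs i) ∣Y∣<∣X∣)
    where
    impossible : ¬ ∃ λ X′ → X′ ⊆ lookup Xs i × ∣ X′ ∣ ≡ suc ∣ lookup Xs j ∣
    impossible (X′ , X′⊆X , ∣X′∣≡) with sat X′ (λ _ → X′⊆X)
    -- The strict bound |Y| < s enters here: X′ has |Y| + 1 elements, which is at most s.
    ... | Y′ , Y′⊆Y , tr = transfer-sound xs (Y′ ∷ X′ ∷ Xs) 0F 1F 4≤s s^5≤q
      (subst (_≤ s) (sym ∣X′∣≡) ∣Y∣<s) tr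
      (subst (∣ Y′ ∣ <_) (sym ∣X′∣≡) (s≤s (p⊆q⇒∣p∣≤∣q∣ (λ {x} → Y′⊆Y x))))

  Complete : (∀ {m n} → Fin n → Fin n → Fin n → MSO m n) → Set
  Complete φ = ∀ {m n} (xs : Vec (Fin q) m) (Xs : Vec (Subset q) n) g i j →
    Nonempty (lookup Xs g) → ∣ lookup Xs i ∣ ≡ ∣ lookup Xs j ∣ → Sat′ q (φ g i j) xs Xs

  -- Smallness of one of the two sets is enough, so that a block or remainder of unknown size can be
  -- compared with `G` or a subset of `G`.
  SoundBelow : ℕ → ℕ → (∀ {m n} → Fin n → Fin n → Fin n → MSO m n) → Set
  SoundBelow γ t φ = ∀ {m n} (xs : Vec (Fin q) m) (Xs : Vec (Subset q) n) g i j →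
    ∣ lookup Xs g ∣ ≡ γ → Sat′ q (φ g i j) xs Xs →
    ∣ lookup Xs i ∣ < t ⊎ ∣ lookup Xs j ∣ < t → ∣ lookup Xs i ∣ ≡ ∣ lookup Xs j ∣

  module _ {φ : ∀ {m n} → Fin n → Fin n → Fin n → MSO m n} {m n}
           (xs : Vec (Fin q) m) (Xs : Vec (Subset q) n) (g i M B : Fin n) where

    chunked-complete : Complete φ → Nonempty (lookup Xs g) →
      Chunked ∣ lookup Xs g ∣ (lookup Xs i) (lookup Xs M) (lookup Xs B) →
      Sat′ q (chunkedᶠ φ g i M B) xs Xs
    chunked-complete φ-complete ne (blocks , rem) = (λ x x∈M → let K , K-block , ∣K∣≡ = blocks x x∈M in
      K , K-block , φ-complete (x ∷ xs) (K ∷ Xs) (suc g) 0F (suc g) ne ∣K∣≡) , rem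

    chunked-sound : ∀ {γ t} → SoundBelow γ t φ → γ < t → ∣ lookup Xs g ∣ ≡ γ →
      Sat′ q (chunkedᶠ φ g i M B) xs Xs → Chunked γ (lookup Xs i) (lookup Xs M) (lookup Xs B)
    chunked-sound {t = t} φ-sound γ<t ∣G∣≡γ (blocks , rem) =
      (λ x x∈M → let K , K-block , sat = blocks x x∈M
                     ∣K∣≡∣G∣ = φ-sound (x ∷ xs) (K ∷ Xs) (suc g) 0F (suc g) ∣G∣≡γ sat (inj₂ ∣G∣<t) in
         K , K-block , trans ∣K∣≡∣G∣ ∣G∣≡γ) , rem
      where
      ∣G∣<t = subst (_< t) (sym ∣G∣≡γ) γ<t

  -- Sets of equal size have the same quotient and remainder on division by |G|. As |B| < |G|, some
  -- H ⊆ G has the size of the remainder.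
  refine-complete : ∀ k → Complete (refineᶠ k)
  refine-complete zero    xs Xs g i j ne eq = embed-complete xs Xs i j eq , embed-complete xs Xs j i (sym eq)
  refine-complete (suc k) xs Xs g i j ne@(_ , x∈G) eq
    with ∃-Chunked 1≤∣G∣ (lookup Xs i) | ∃-Chunked 1≤∣G∣ (lookup Xs j)
    where
    1≤∣G∣ : 1 ≤ ∣ lookup Xs g ∣
    1≤∣G∣ = ≤-trans (s≤s z≤n) (x∈p⇒∣p-x∣<∣p∣ x∈G)
  ... | M , B , _ , ∣B∣< , X-chunked | N , C , _ , ∣C∣< , Y-chunked
    with divMod-unique ∣B∣< ∣C∣< (trans (sym (∣Chunked∣ _ M B X-chunked)) (trans eq (∣Chunked∣ _ N C Y-chunked)))
       | ∃-⊆-size (lookup Xs g) (<⇒≤ ∣B∣<)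
  ... | ∣M∣≡∣N∣ , ∣B∣≡∣C∣ | H , H⊆G , ∣H∣≡∣B∣ =
    M , N , B , C , H ,
    chunked-complete {φ = refineᶠ k} xs Ys g′ (5↑ i) 4F 2F (refine-complete k) ne X-chunked ,
    chunked-complete {φ = refineᶠ k} xs Ys g′ (5↑ j) 3F 1F (refine-complete k) ne Y-chunked ,
    refine-complete k xs Ys g′ 4F 3F ne ∣M∣≡∣N∣ ,
    (λ _ → H⊆G) ,
    refine-complete k xs Ys g′ 2F 0F ne (sym ∣H∣≡∣B∣) ,
    refine-complete k xs Ys g′ 1F 0F ne (sym (trans ∣H∣≡∣B∣ ∣B∣≡∣C∣))
    where
    Ys = H ∷ C ∷ B ∷ N ∷ M ∷ Xs
    g′ = 5↑ g

  -- By |X| = γ |M| + |B|, a bound `γ ^ suc k * s` on a set becomes `γ ^ k * s` on its number of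
  -- blocks. Since γ < s, `G` and `H` are below the latter bound too, so block sizes and remainders
  -- are also compared exactly.
  refine-sound : ∀ {s γ} → 4 ≤ s → s ^ 5 ≤ q → 1 ≤ γ → γ < s →
                 ∀ k → SoundBelow γ (γ ^ k * s) (refineᶠ k)
  refine-sound {s} 4≤s s^5≤q 1≤γ γ<s zero xs Xs g i j ∣G∣ (i↪j , j↪i) small
    with subst (λ t → ∣ lookup Xs i ∣ < t ⊎ ∣ lookup Xs j ∣ < t) (+-identityʳ s) small
  -- `embed-sound` needs a small target. The embedding into the small set comes first and shows the
  -- other set to be small, which permits the converse.
  ... | inj₁ ∣X∣<s = let Y≤X = embed-sound xs Xs j i 4≤s s^5≤q ∣X∣<s j↪i in
    ≤-antisym (embed-sound xs Xs i j 4≤s s^5≤q (≤-<-trans Y≤X ∣X∣<s) i↪j) Y≤X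
  ... | inj₂ ∣Y∣<s = let X≤Y = embed-sound xs Xs i j 4≤s s^5≤q ∣Y∣<s i↪j in
    ≤-antisym X≤Y (embed-sound xs Xs j i 4≤s s^5≤q (≤-<-trans X≤Y ∣Y∣<s) j↪i)
  refine-sound {s} {γ} 4≤s s^5≤q 1≤γ γ<s (suc k) xs Xs g i j ∣G∣≡γ
    (M , N , B , C , H , X-sat , Y-sat , M~N , H⊆G , B~H , C~H) small = begin
      ∣ lookup Xs i ∣       ≡⟨ ∣X∣≡ ⟩
      γ * ∣ M ∣ + ∣ B ∣     ≡⟨ cong₂ (λ a b → γ * a + b) ∣M∣≡∣N∣ (trans ∣B∣≡∣H∣ (sym ∣C∣≡∣H∣)) ⟩
      γ * ∣ N ∣ + ∣ C ∣     ≡⟨ ∣Y∣≡ ⟨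
      ∣ lookup Xs j ∣       ∎
    where
    open ≡-Reasoning
    Ys = H ∷ C ∷ B ∷ N ∷ M ∷ Xs
    g′ = 5↑ g
    ih = refine-sound 4≤s s^5≤q 1≤γ γ<s k
    γ<t : γ < γ ^ k * s
    γ<t = <-≤-trans γ<s (m≤n*m s (γ ^ k) {{m^n≢0 γ k {{>-nonZero 1≤γ}}}})
    ∣X∣≡ = ∣Chunked∣ _ M B (chunked-sound {φ = refineᶠ k} xs Ys g′ (5↑ i) 4F 2F ih γ<t ∣G∣≡γ X-sat)
    ∣Y∣≡ = ∣Chunked∣ _ N C (chunked-sound {φ = refineᶠ k} xs Ys g′ (5↑ j) 3F 1F ih γ<t ∣G∣≡γ Y-sat)
    ∣H∣<t = ≤-<-trans (≤-trans (p⊆q⇒∣p∣≤∣q∣ (λ {x} → H⊆G x)) (≤-reflexive ∣G∣≡γ)) γ<t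
    ∣B∣≡∣H∣ = ih xs Ys g′ 2F 0F ∣G∣≡γ B~H (inj₂ ∣H∣<t)
    ∣C∣≡∣H∣ = ih xs Ys g′ 1F 0F ∣G∣≡γ C~H (inj₂ ∣H∣<t)
    shrink : ∀ {x a b} → x ≡ γ * a + b → x < γ ^ suc k * s → a < γ ^ k * s
    shrink {x} {a} {b} x≡ x< = *-cancelˡ-< γ a (γ ^ k * s)
      (subst (γ * a <_) (*-assoc γ (γ ^ k) s) (≤-<-trans (subst (γ * a ≤_) (sym x≡) (m≤m+n _ b)) x<))
    ∣M∣≡∣N∣ = ih xs Ys g′ 4F 3F ∣G∣≡γ M~N (Data.Sum.map (shrink ∣X∣≡) (shrink ∣Y∣≡) small)

  bounded-complete : ∀ k {m n} (xs : Vec (Fin q) m) (Xs : Vec (Subset q) n) i j →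
    ∣ lookup Xs i ∣ ≡ ∣ lookup Xs j ∣ → Sat′ q (boundedᶠ k i j) xs Xs
  bounded-complete zero    xs Xs i j eq = λ _ x∈ → x∈
  bounded-complete (suc k) xs Xs i j eq with nonempty? (lookup Xs i) | nonempty? (lookup Xs j)
  ... | no X-empty | no Y-empty = inj₁ (X-empty , Y-empty)
  ... | no X-empty | yes (y , y∈Y) =
    ⊥-elim (n≮0 (subst (∣ lookup Xs j - y ∣ <_) (trans (sym eq) (∣Empty∣ X-empty)) (x∈p⇒∣p-x∣<∣p∣ y∈Y)))
  ... | yes (x , x∈X) | no Y-empty =
    ⊥-elim (n≮0 (subst (∣ lookup Xs i - x ∣ <_) (trans eq (∣Empty∣ Y-empty)) (x∈p⇒∣p-x∣<∣p∣ x∈X)))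
  ... | yes X-ne | yes Y-ne with ∃-predecessor (lookup Xs i) X-ne | ∃-predecessor (lookup Xs j) Y-ne
  ... | K , K-pred | L , L-pred = inj₂ (K , L , K-pred , L-pred ,
    bounded-complete k xs (L ∷ K ∷ Xs) 1F 0F
      (suc-injective (trans (sym (∣IsPredecessor∣ _ K K-pred)) (trans eq (∣IsPredecessor∣ _ L L-pred)))))

  bounded-sound : ∀ k {m n} (xs : Vec (Fin q) m) (Xs : Vec (Subset q) n) i j →
    Sat′ q (boundedᶠ k i j) xs Xs → ∣ lookup Xs i ∣ < k → ∣ lookup Xs i ∣ ≡ ∣ lookup Xs j ∣
  bounded-sound (suc k) xs Xs i j (inj₁ (X-empty , Y-empty)) ∣X∣<k =
    trans (∣Empty∣ X-empty) (sym (∣Empty∣ Y-empty))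
  bounded-sound (suc k) xs Xs i j (inj₂ (K , L , K-pred , L-pred , sat)) ∣X∣<k =
    trans ∣X∣≡ (trans (cong suc ∣K∣≡∣L∣) (sym (∣IsPredecessor∣ _ L L-pred)))
    where
    ∣X∣≡ = ∣IsPredecessor∣ _ K K-pred
    ∣K∣≡∣L∣ = bounded-sound k xs (L ∷ K ∷ Xs) 1F 0F sat (s≤s⁻¹ (subst (_< suc k) ∣X∣≡ ∣X∣<k))

-- Definitions of equal cardinality, addition and multiplication

module EqCardDefinition (K k : ℕ)
  (covered : ∀ q → q < K ⊎ ∃ λ γ → 3 ≤ γ × suc γ ^ 5 ≤ q × q < γ ^ k * suc γ) where

  -- `boundedᶠ` settles q < K. Otherwise `covered` supplies γ = |G|; with s = γ + 1, the range of
  -- `refineᶠ k` exceeds q.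
  eqCardᶠ : ∀ {m n} → Fin n → Fin n → MSO m n
  eqCardᶠ i j = boundedᶠ K i j ∧ᶠ ∀² (nonemptyᶠ 0F ⇒ᶠ refineᶠ k 0F (suc i) (suc j))

  module _ {q m n} (xs : Vec (Fin q) m) (Xs : Vec (Subset q) n) (i j : Fin n) where

    eqCard-complete : ∣ lookup Xs i ∣ ≡ ∣ lookup Xs j ∣ → Sat′ q (eqCardᶠ i j) xs Xs
    eqCard-complete eq =
      bounded-complete K xs Xs i j eq ,
      λ G ne → refine-complete k xs (G ∷ Xs) 0F (suc i) (suc j) ne eq

    eqCard-sound : Sat′ q (eqCardᶠ i j) xs Xs → ∣ lookup Xs i ∣ ≡ ∣ lookup Xs j ∣
    eqCard-sound (bounded , refined) with covered q
    ... | inj₁ q<K = bounded-sound K xs Xs i j bounded (≤-<-trans (∣p∣≤n (lookup Xs i)) q<K)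
    ... | inj₂ (γ , 3≤γ , s^5≤q , q<)
      with ∃-⊆-size {q} ⊤ {γ} (subst (γ ≤_) (sym (∣⊤∣≡n q))
             (≤-trans (n≤1+n γ) (≤-trans (m≤m*n (suc γ) (suc γ ^ 4) {{m^n≢0 (suc γ) 4}}) s^5≤q)))
    ... | G , _ , ∣G∣≡γ =
      refine-sound (s≤s 3≤γ) s^5≤q 1≤γ ≤-refl k xs (G ∷ Xs) 0F (suc i) (suc j) ∣G∣≡γ
        (refined G (∣∣>0⇒Nonempty (subst (1 ≤_) (sym ∣G∣≡γ) 1≤γ)))
        (inj₁ (≤-<-trans (∣p∣≤n (lookup Xs i)) q<))
      where
      1≤γ : 1 ≤ γ
      1≤γ = ≤-trans (s≤s z≤n) 3≤γ

  eqCard-definable : FiniteDefinableℱ PrimeCard EqCard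
  eqCard-definable = eqCardᶠ 0F 1F , λ { q _ (X ∷ Y ∷ []) → mk⇔
    (λ sat → trans (card-toℱ X) (trans (eqCard-sound [] (X ∷ Y ∷ []) 0F 1F sat) (sym (card-toℱ Y))))
    (λ eq → eqCard-complete [] (X ∷ Y ∷ []) 0F 1F (trans (sym (card-toℱ X)) (trans eq (card-toℱ Y)))) }

  -- x + y = z is expressed as x ≤ z and |[x,z)| = |[0,y)|.
  +-definable : FiniteDefinableℕ PrimeCard Graph+
  +-definable = formula , λ { q _ (x ∷ y ∷ z ∷ []) → mk⇔ (sound x y z) (complete x y z) }
    where
    formula : MSO 3 0
    formula = ¬ᶠ 2F <ᶠ 0F ∧ᶠ ∃² (∃² (intervalᶠ 0F 2F 1F ∧ᶠ initialᶠ 1F 0F ∧ᶠ eqCardᶠ 1F 0F))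

    module _ {q} (x y z : Fin q) where

      xs = x ∷ y ∷ z ∷ []

      sound : Sat′ q formula xs [] → toℕ x + toℕ y ≡ toℕ z
      sound (z≮x , B , A , B-interval , A-initial , B~A) = begin
        toℕ x + toℕ y   ≡⟨ cong (toℕ x +_) (∣IsInitial-toℕ∣ y A-initial) ⟨
        toℕ x + ∣ A ∣   ≡⟨ cong (toℕ x +_) (eqCard-sound xs (A ∷ B ∷ []) 1F 0F B~A) ⟨
        toℕ x + ∣ B ∣   ≡⟨ ∣IsInterval∣ B x z z≮x B-interval ⟩
        toℕ z           ∎
        where open ≡-Reasoning

      complete : toℕ x + toℕ y ≡ toℕ z → Sat′ q formula xs []
      complete x+y≡z = z≮x , B , A , B-interval , A-initial ,
        eqCard-complete xs (A ∷ B ∷ []) 1F 0F (trans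
          (+-cancelˡ-≡ (toℕ x) ∣ B ∣ (toℕ y) (trans (∣IsInterval∣ B x z z≮x B-interval) (sym x+y≡z)))
          (sym (∣IsInitial-toℕ∣ y A-initial)))
        where
        z≮x = ≤⇒≯ (subst (toℕ x ≤_) x+y≡z (m≤m+n (toℕ x) (toℕ y)))
        B = interval (toℕ x) (toℕ z)
        B-interval = interval-IsInterval {q} (toℕ x) (toℕ z)
        A = initial (toℕ y)
        A-initial = initial-IsInitial {q} (toℕ y)

  -- For x > 0, x y = z means that [0,z) falls into y blocks of size x with nothing left over.
  -- Cutting requires a positive block size, so x = 0 has its own disjunct.
  ×-definable : FiniteDefinableℕ PrimeCard Graph×
  ×-definable = formula , λ { q _ (x ∷ y ∷ z ∷ []) → mk⇔ (sound x y z) (complete x y z) }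
    where
    formula : MSO 3 0
    formula = (isZeroᶠ 0F ∧ᶠ isZeroᶠ 2F) ∨ᶠ
      -- 4F, 3F and 2F are [0,x), [0,y) and [0,z); 1F is the set of cuts and 0F the remainder.
      ∃² (∃² (∃² (∃² (∃² (
        initialᶠ 0F 4F ∧ᶠ initialᶠ 1F 3F ∧ᶠ initialᶠ 2F 2F ∧ᶠ ¬ᶠ nonemptyᶠ 0F ∧ᶠ
        chunkedᶠ (λ _ → eqCardᶠ) 4F 2F 1F 0F ∧ᶠ eqCardᶠ 1F 3F)))))

    isZero⇒≡0 : ∀ {q} (x : Fin q) → ¬ ∃ (Fin._< x) → toℕ x ≡ 0
    isZero⇒≡0 zero    _ = refl
    isZero⇒≡0 (suc x) x-zero = ⊥-elim (x-zero (zero , s≤s z≤n))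

    ≡0⇒isZero : ∀ {q} (x : Fin q) → toℕ x ≡ 0 → ¬ ∃ (Fin._< x)
    ≡0⇒isZero zero _ (_ , ())

    module _ {q} (x y z : Fin q) where

      xs = x ∷ y ∷ z ∷ []

      sound : Sat′ q formula xs [] → toℕ x * toℕ y ≡ toℕ z
      sound (inj₁ (x-zero , z-zero)) =
        trans (cong (_* toℕ y) (isZero⇒≡0 x x-zero)) (sym (isZero⇒≡0 z z-zero))
      sound (inj₂ (G , Y , X , M , B , G-init , Y-init , X-init , B-empty , chunked , M~Y)) = begin
        toℕ x * toℕ y          ≡⟨ cong₂ _*_ (∣IsInitial-toℕ∣ x G-init) (∣IsInitial-toℕ∣ y Y-init) ⟨
        ∣ G ∣ * ∣ Y ∣          ≡⟨ cong (∣ G ∣ *_) (eqCard-sound xs Xs 1F 3F M~Y) ⟨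
        ∣ G ∣ * ∣ M ∣          ≡⟨ +-identityʳ _ ⟨
        ∣ G ∣ * ∣ M ∣ + 0      ≡⟨ cong (∣ G ∣ * ∣ M ∣ +_) (∣Empty∣ B-empty) ⟨
        -- `eqCardᶠ` is exact at every size; `suc ∣ G ∣` is the least threshold above |G|.
        ∣ G ∣ * ∣ M ∣ + ∣ B ∣  ≡⟨ ∣Chunked∣ X M B (chunked-sound {φ = λ _ → eqCardᶠ} xs Xs 4F 2F 1F 0F
                                   {t = suc ∣ G ∣}
                                   (λ xs Xs _ i j _ sat _ → eqCard-sound xs Xs i j sat) ≤-refl refl chunked) ⟨
        ∣ X ∣                  ≡⟨ ∣IsInitial-toℕ∣ z X-init ⟩
        toℕ z                  ∎
        where
        open ≡-Reasoning
        Xs = B ∷ M ∷ X ∷ Y ∷ G ∷ []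

      complete : toℕ x * toℕ y ≡ toℕ z → Sat′ q formula xs []
      complete x*y≡z with toℕ x ≟ 0
      ... | yes x≡0 = inj₁ (≡0⇒isZero x x≡0 , ≡0⇒isZero z (trans (sym x*y≡z) (cong (_* toℕ y) x≡0)))
      ... | no  x≢0 with ∃-Chunked (n≢0⇒n>0 x≢0) (initial {q} (toℕ z))
      ... | M , B , _ , ∣B∣<x , X-chunked
        with divMod-unique ∣B∣<x (n≢0⇒n>0 x≢0) (begin
          toℕ x * ∣ M ∣ + ∣ B ∣         ≡⟨ ∣Chunked∣ X M B X-chunked ⟨
          ∣ X ∣                         ≡⟨ ∣IsInitial-toℕ∣ z X-init ⟩
          toℕ z                         ≡⟨ x*y≡z ⟨
          toℕ x * toℕ y                 ≡⟨ +-identityʳ _ ⟨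
          toℕ x * toℕ y + 0             ∎)
        where
        open ≡-Reasoning
        X = initial (toℕ z)
        X-init = initial-IsInitial {q} (toℕ z)
      ... | ∣M∣≡y , ∣B∣≡0 = inj₂ (G , Y , X , M , B , G-init , Y-init , X-init ,
        (λ (b , b∈B) → n≮0 (subst (∣ B - b ∣ <_) ∣B∣≡0 (x∈p⇒∣p-x∣<∣p∣ b∈B))) ,
        chunked-complete {φ = λ _ → eqCardᶠ} xs Xs 4F 2F 1F 0F
          (λ xs Xs _ i j _ → eqCard-complete xs Xs i j) G-ne
          (subst (λ g → Chunked g X M B) (sym ∣G∣≡x) X-chunked) ,
        eqCard-complete xs Xs 1F 3F (trans ∣M∣≡y (sym (∣IsInitial-toℕ∣ y Y-init))))
        where
        G = initial {q} (toℕ x)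
        Y = initial {q} (toℕ y)
        X = initial {q} (toℕ z)
        Xs = B ∷ M ∷ X ∷ Y ∷ G ∷ []
        G-init = initial-IsInitial {q} (toℕ x)
        Y-init = initial-IsInitial {q} (toℕ y)
        X-init = initial-IsInitial {q} (toℕ z)
        ∣G∣≡x = ∣IsInitial-toℕ∣ x G-init
        G-ne = ∣∣>0⇒Nonempty (subst (1 ≤_) (sym ∣G∣≡x) (n≢0⇒n>0 x≢0))

proposition4p9 : FiniteDefinableℱ PrimeCard EqCard ×
    FiniteDefinableℕ PrimeCard Graph+ ×
    FiniteDefinableℕ PrimeCard Graph×
proposition4p9 = eqCard-definable , +-definable , ×-definable
  where
  covered : ∀ q → q < 1024 ⊎ ∃ λ γ → 3 ≤ γ × suc γ ^ 5 ≤ q × q < γ ^ 9 * suc γ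
  covered q with q <? 1024
  ... | yes q<1024 = inj₁ q<1024
  ... | no  q≮1024 = inj₂ (fifth-root (≮⇒≥ q≮1024))
  open EqCardDefinition 1024 9 covered
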